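{- Let $\mathfrak{A}$ be a model of Presburger Arithmetic $\mathrm{PrA}$ that is one-dimensionally interpreted in the structure $(\mathbb{N},+)$ via a one-dimensional interpretation $\iota$. Then (a) $\mathfrak{A}$ is isomorphic to $(\mathbb{N},+)$; and (b) the isomorphism is definable in $(\mathbb{N},+)$, i.e. $\iota$ is definably isomorphic to the trivial (identity) one-dimensional interpretation of $(\mathbb{N},+)$ in $(\mathbb{N},+)$.
   Context: Presburger Arithmetic $\mathrm{PrA}$ is the first-order theory of $(\mathbb{N},+)$ (signature $\{=,+\}$). "Definable" means first-order definable without parameters in $(\mathbb{N},+)$. An $m$-dimensional translation $\iota$ from a signature $\Omega_1$ to a signature $\Omega_2$ consists of $\Omega_2$-formulas $\mathit{Dom}_\iota(\bar y)$ (with $\bar y$ an $m$-tuple of variables), $\mathit{Pred}_{\iota,P}(\bar y_1,\dots,\bar y_n)$ for each $n$-ary predicate $P$ of $\Omega_1$ (including equality), and $\mathit{Fun}_{\iota,f}(\bar y_0,\bar y_1,\dots,\bar y_n)$ for each $n$-ary function symbol $f$ of $\Omega_1$, each $\bar y_i$ an $m$-tuple. It is an interpretation of an $\Omega_1$-structure $\mathfrak{A}$ (domain $A$) in an $\Omega_2$-structure $\mathfrak{B}$ (domain $B$) if $\mathit{Dom}_\iota$ defines a nonempty $D\subseteq B^m$, $\mathit{Pred}_{\iota,=}$ defines an equivalence relation $\sim$ on $D$, and there is a bijection $h:D/{\sim}\to A$ such that for all $\bar b_i\in D$: $\mathfrak{A}\models P(h([\bar b_1]),\dots,h([\bar b_n]))$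 iff $\mathfrak{B}\models \mathit{Pred}_{\iota,P}(\bar b_1,\dots,\bar b_n)$, and $\mathfrak{A}\models h([\bar b_0])=f(h([\bar b_1]),\dots,h([\bar b_n]))$ iff $\mathfrak{B}\models\mathit{Fun}_{\iota,f}(\bar b_0,\dots,\bar b_n)$. A structure is $m$-dimensionally interpreted in $\mathfrak{B}$ if some $m$-dimensional translation is an interpretation of it in $\mathfrak{B}$. If $\iota_1,\iota_2$ are interpretations (of dimensions $m_1,m_2$, with domains $D_1,D_2$ and equivalences $\sim_1,\sim_2$) of the same structure $\mathfrak{A}$ in $\mathfrak{B}$, an $\Omega_2$-formula $I(\bar y,\bar z)$ ($\bar y$ of length $m_1$, $\bar z$ of length $m_2$) defines an isomorphism between them if the bijections $h_1,h_2$ can be chosen so that for all $\bar b\in D_1,\bar c\in D_2$: $h_1([\bar b]_{\sim_1})=h_2([\bar c]_{\sim_2})$ iff $\mathfrak{B}\models I(\bar b,\bar c)$; $\iota_1,\iota_2$ are definably isomorphic if such $I$ exists. The trivial interpretation of $(\mathbb{N},+)$ in itself is the one-dimensional one with domain formula $\top$, equality interpreted as equality and $+$ as $+$. -}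

module Defs where

open import Data.Nat using (ℕ; zero; suc; _+_)
open import Data.Fin using (Fin; zero; suc)
open import Data.Product using (Σ; _×_; _,_; proj₁)
open import Data.Sum using (_⊎_)
open import Data.Unit using (⊤)
open import Data.Empty using (⊥)
open import Relation.Nullary using (¬_)
open import Relation.Binary.PropositionalEquality using (_≡_)
open import Function.Bundles using (_⇔_)
open import Function.Definitions using (Bijective)

data Term (n : ℕ) : Set where
  var  : Fin n → Term n
  _⊕ₜ_ : Term n → Term n → Term n

infix 4 _≐_
data Formula (n : ℕ) : Set where
  _≐_  : Term n → Term n → Formula n
  ⊤'   : Formula n
  ⊥'   : Formula n
  ¬'_  : Formula n → Formula n
  _∧'_ : Formula n → Formula n → Formula n
  _∨'_ : Formula n → Formula n → Formula n
  _⇒'_ : Formula n → Formula n → Formula n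
  ∀'_  : Formula (suc n) → Formula n
  ∃'_  : Formula (suc n) → Formula n

record Structure : Set₁ where
  field
    Carrier : Set
    _⊕_     : Carrier → Carrier → Carrier
open Structure public

ℕStr : Structure
ℕStr = record { Carrier = ℕ ; _⊕_ = _+_ }

extend : {A : Set} {n : ℕ} → A → (Fin n → A) → Fin (suc n) → A
extend a ρ zero    = a
extend a ρ (suc i) = ρ i

evalT : (S : Structure) {n : ℕ} → Term n → (Fin n → Carrier S) → Carrier S
evalT S (var i)  ρ = ρ i
evalT S (s ⊕ₜ t) ρ = _⊕_ S (evalT S s ρ) (evalT S t ρ)

Sat : (S : Structure) {n : ℕ} → Formula n → (Fin n → Carrier S) → Set
Sat S (s ≐ t)   ρ = evalT S s ρ ≡ evalT S t ρ
Sat S ⊤'        ρ = ⊤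
Sat S ⊥'        ρ = ⊥
Sat S (¬' φ)    ρ = ¬ Sat S φ ρ
Sat S (φ ∧' ψ)  ρ = Sat S φ ρ × Sat S ψ ρ
Sat S (φ ∨' ψ)  ρ = Sat S φ ρ ⊎ Sat S ψ ρ
Sat S (φ ⇒' ψ)  ρ = Sat S φ ρ → Sat S ψ ρ
Sat S (∀' φ)    ρ = (a : Carrier S) → Sat S φ (extend a ρ)
Sat S (∃' φ)    ρ = Σ (Carrier S) λ a → Sat S φ (extend a ρ)

empty : {A : Set} → Fin 0 → A
empty ()

env1 : ℕ → Fin 1 → ℕ
env1 x = extend x empty

env2 : ℕ → ℕ → Fin 2 → ℕ
env2 x y = extend x (env1 y)

env3 : ℕ → ℕ → ℕ → Fin 3 → ℕ
env3 x y z = extend x (env2 y z)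

ℕ⊨ : {n : ℕ} → Formula n → (Fin n → ℕ) → Set
ℕ⊨ = Sat ℕStr

ModelOfPrA : Structure → Set
ModelOfPrA S = (φ : Formula 0) → ℕ⊨ φ empty → Sat S φ empty

record Translation1 : Set where
  field
    Dom  : Formula 1
    Eq   : Formula 2
    Plus : Formula 3   -- Fun_+(y0,y1,y2)  meaning  y0 = y1 + y2
open Translation1 public

InD : Translation1 → ℕ → Set
InD ι b = ℕ⊨ (Dom ι) (env1 b)

D : Translation1 → Set
D ι = Σ ℕ (InD ι)

_~[_]_ : ℕ → Translation1 → ℕ → Set
b ~[ ι ] c = ℕ⊨ (Eq ι) (env2 b c)

-- ι is an interpretation of S in (ℕ,+), witnessed by h.
-- D/~ → A is represented as a map h : D → A that is constant on ~-classes,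
-- with kernel exactly ~ (so the induced map on D/~ is injective), and surjective.
record IsInterpretation (ι : Translation1) (S : Structure) (h : D ι → Carrier S) : Set where
  field
    nonempty  : D ι
    ~-refl    : (d : D ι) → proj₁ d ~[ ι ] proj₁ d
    ~-sym     : (d e : D ι) → proj₁ d ~[ ι ] proj₁ e → proj₁ e ~[ ι ] proj₁ d
    ~-trans   : (d e f : D ι) → proj₁ d ~[ ι ] proj₁ e → proj₁ e ~[ ι ] proj₁ f
                → proj₁ d ~[ ι ] proj₁ f
    surj      : (a : Carrier S) → Σ (D ι) λ d → h d ≡ a
    kernel    : (d e : D ι) → (h d ≡ h e) ⇔ (proj₁ d ~[ ι ] proj₁ e)
    plus      : (d₀ d₁ d₂ : D ι)
                → (h d₀ ≡ _⊕_ S (h d₁) (h d₂)) ⇔ ℕ⊨ (Plus ι) (env3 (proj₁ d₀) (proj₁ d₁) (proj₁ d₂))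

Interprets : Translation1 → Structure → Set
Interprets ι S = Σ (D ι → Carrier S) (IsInterpretation ι S)

trivial : Translation1
trivial = record
  { Dom  = ⊤'
  ; Eq   = var zero ≐ var (suc zero)
  ; Plus = var zero ≐ (var (suc zero) ⊕ₜ var (suc (suc zero)))
  }

DefinablyIsomorphic : Translation1 → Translation1 → Structure → Set
DefinablyIsomorphic ι₁ ι₂ S =
  Σ (Formula 2) λ I →
  Σ (D ι₁ → Carrier S) λ h₁ → IsInterpretation ι₁ S h₁ ×
  Σ (D ι₂ → Carrier S) λ h₂ → IsInterpretation ι₂ S h₂ ×
  ((d₁ : D ι₁) (d₂ : D ι₂) → (h₁ d₁ ≡ h₂ d₂) ⇔ ℕ⊨ I (env2 (proj₁ d₁) (proj₁ d₂)))

Isomorphic : Structure → Structure → Set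
Isomorphic S T =
  Σ (Carrier S → Carrier T) λ f →
    Bijective _≡_ _≡_ f × ((x y : Carrier S) → f (_⊕_ S x y) ≡ _⊕_ T (f x) (f y))

{-# OPTIONS --safe #-}
module Submission where

-- Coding each element of A by its least representative turns A into a definable
-- subset U of ℕ with a definable order ≺. By quantifier elimination there are p and
-- N such that for x ≥ N both x ∈ U and x ≺ x + p depend only on x mod p; by
-- transitivity every residue class mod p is then, beyond N, either disjoint from U
-- or ≺-monotone. A monotone sequence is cofinal in at most one of the intervals
-- [ j b , (j + 1) b ), so among p + 1 of them one is finite, and hence so is
-- [ 0 , b ). Thus every element of A is a numeral. The numeral n has exactly n
-- predecessors; in each residue class they form an initial segment, so their number
-- is a sum of finitely many definable functions, which defines the isomorphism.

open import Defs
open import Data.Bool using (Bool; true; false; not; _∧_)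
open import Data.Bool.Properties using () renaming (_≟_ to _≟ᵇ_)
open import Data.Empty using (⊥-elim)
open import Data.Fin as Fin using (Fin; zero; suc; toℕ; fromℕ<)
import Data.Fin.Properties as Finₚ
open import Data.Integer as ℤ using (ℤ; +_; -[1+_]; +[1+_]; 0ℤ; ∣_∣)
import Data.Integer.Properties as ℤₚ
open import Data.Integer.Divisibility.Signed as ℤ∣ using (divides) renaming (_∣_ to _∣ℤ_; _∣?_ to _∣ℤ?_)
open import Data.Integer.Tactic.RingSolver using (solve-∀)
open import Data.List using (List; []; _∷_; _++_; map; concatMap; upTo)
open import Data.List.Membership.Propositional using (_∈_; find; lose)
open import Data.List.Membership.Propositional.Properties
open import Data.List.Relation.Unary.Any using (here; there)
open import Data.Nat as ℕ using (ℕ; zero; suc; _+_; _*_; _∸_; _≤_; _<_; _⊔_; s≤s; z≤n; NonZero)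
import Data.Nat.Properties as ℕₚ
open import Data.Nat.Divisibility as ℕ∣ using () renaming (_∣_ to _∣ℕ_)
open import Data.Nat.DivMod using (_/_; _%_; m≡m%n+[m/n]*n; m%n<n)
open import Data.Nat.Induction using (<-rec)
open import Data.Product using (Σ; ∃; _×_; _,_; proj₁; proj₂)
open import Data.Sum using (_⊎_; inj₁; inj₂; [_,_])
open import Data.Unit using (tt)
open import Function using (_∘_; _⇔_; mk⇔; Equivalence)
open import Function.Construct.Composition using (_⇔-∘_)
open import Function.Construct.Identity using (⇔-id)
open import Function.Construct.Symmetry using (⇔-sym)
open import Relation.Binary using (tri<; tri≈; tri>)
open import Relation.Binary.PropositionalEquality hiding ([_])
open import Relation.Nullary using (¬_; Dec; yes; no; does)
open import Relation.Nullary.Decidable using (does-⇔; dec-true; dec-false; map′)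
open Equivalence using (to; from)

-- Quantifier elimination

-- The order `≺` has nothing to do with the order of ℕ, and a nonstandard `A` would have infinite
-- initial segments; only the tameness of definable sets rules this out. The shift `p` in
-- `x ≺ x + p` has to be a multiple of the moduli produced by quantifier elimination, so the
-- elimination is applied to the two-variable formula for `≺` before the shift is chosen.
-- Satisfaction is read constructively, so case distinctions over ℕ must be decisions. Elimination
-- supplies them, which is why even auxiliary properties, such as a class meeting an interval beyond
-- a bound, are shown to be definable. The number of elements below a given one is not first-order
-- expressible for an arbitrary definable order. Here the number of classes is the fixed `N + p`,
-- each number below `N` forming a class of its own, so a sum of fixed length suffices.

infixr 5 _∷_
infixl 6 _⊞_
infixl 7 _·_
infixr 6 _&_

Env : ℕ → Set
Env n = Fin n → ℕ

data Lin : ℕ → Set where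
  con : ℤ → Lin 0
  _∷_ : ∀ {n} → ℤ → Lin n → Lin (suc n)

ev : ∀ {n} → Lin n → Env n → ℤ
ev (con c) ρ = c
ev (a ∷ l) ρ = a ℤ.* + ρ zero ℤ.+ ev l (ρ ∘ suc)

const : ∀ {n} → ℤ → Lin n
const {zero}  c = con c
const {suc n} c = 0ℤ ∷ const c

varˡ : ∀ {n} → Fin n → Lin n
varˡ zero    = + 1 ∷ const 0ℤ
varˡ (suc i) = 0ℤ ∷ varˡ i

_⊞_ : ∀ {n} → Lin n → Lin n → Lin n
con c   ⊞ con d   = con (c ℤ.+ d)
(a ∷ l) ⊞ (b ∷ m) = (a ℤ.+ b) ∷ (l ⊞ m)

_·_ : ∀ {n} → ℤ → Lin n → Lin n
k · con c   = con (k ℤ.* c)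
k · (a ∷ l) = (k ℤ.* a) ∷ (k · l)

ev-const : ∀ {n} c (ρ : Env n) → ev (const c) ρ ≡ c
ev-const {zero}  c ρ = refl
ev-const {suc n} c ρ = trans (ℤₚ.+-identityˡ _) (ev-const c (ρ ∘ suc))

ev-var : ∀ {n} (i : Fin n) (ρ : Env n) → ev (varˡ i) ρ ≡ + ρ i
ev-var zero    ρ = trans (cong₂ ℤ._+_ (ℤₚ.*-identityˡ (+ ρ zero)) (ev-const 0ℤ (ρ ∘ suc))) (ℤₚ.+-identityʳ (+ ρ zero))
ev-var (suc i) ρ = trans (ℤₚ.+-identityˡ _) (ev-var i (ρ ∘ suc))

ev-⊞ : ∀ {n} (l m : Lin n) ρ → ev (l ⊞ m) ρ ≡ ev l ρ ℤ.+ ev m ρ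
ev-⊞ (con c) (con d) ρ = refl
ev-⊞ (a ∷ l) (b ∷ m) ρ rewrite ev-⊞ l m (ρ ∘ suc) = rearrange a b _ _ _
  where
  rearrange : ∀ a b x s t →
    (a ℤ.+ b) ℤ.* x ℤ.+ (s ℤ.+ t) ≡ (a ℤ.* x ℤ.+ s) ℤ.+ (b ℤ.* x ℤ.+ t)
  rearrange = solve-∀

ev-· : ∀ {n} k (l : Lin n) ρ → ev (k · l) ρ ≡ k ℤ.* ev l ρ
ev-· k (con c) ρ = refl
ev-· k (a ∷ l) ρ rewrite ev-· k l (ρ ∘ suc) = rearrange k a _ _
  where
  rearrange : ∀ k a x s → k ℤ.* a ℤ.* x ℤ.+ k ℤ.* s ≡ k ℤ.* (a ℤ.* x ℤ.+ s)
  rearrange = solve-∀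

-- The modulus of dvd d l is suc d.
data QF (n : ℕ) : Set where
  bool : Bool → QF n
  pos  : Lin n → QF n
  dvd  : ℕ → Lin n → QF n
  neg  : QF n → QF n
  _&_  : QF n → QF n → QF n

isPos : ℤ → Bool
isPos z = does (0ℤ ℤ.<? z)

isDiv : ℕ → ℤ → Bool
isDiv d z = does (+[1+ d ] ∣ℤ? z)

⟦_⟧ : ∀ {n} → QF n → Env n → Bool
⟦ bool b ⟧  ρ = b
⟦ pos l ⟧   ρ = isPos (ev l ρ)
⟦ dvd d l ⟧ ρ = isDiv d (ev l ρ)
⟦ neg θ ⟧   ρ = not (⟦ θ ⟧ ρ)
⟦ θ & η ⟧   ρ = ⟦ θ ⟧ ρ ∧ ⟦ η ⟧ ρ

isPos-scale : ∀ a z → isPos (+[1+ a ] ℤ.* z) ≡ isPos z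
isPos-scale a z = does-⇔ (mk⇔ down up) (0ℤ ℤ.<? _) (0ℤ ℤ.<? _)
  where
  A = +[1+ a ]
  down : 0ℤ ℤ.< A ℤ.* z → 0ℤ ℤ.< z
  down h = ℤₚ.*-cancelˡ-<-nonNeg A (subst (ℤ._< A ℤ.* z) (sym (ℤₚ.*-zeroʳ A)) h)
  up : 0ℤ ℤ.< z → 0ℤ ℤ.< A ℤ.* z
  up h = subst (ℤ._< A ℤ.* z) (ℤₚ.*-zeroʳ A) (ℤₚ.*-monoˡ-<-pos A h)

-- The index `d + a * suc d` stands for the product of the moduli, since its successor reduces to
-- `suc a * suc d`. Scaling modulus and number together clears the denominator of a substituted
-- fraction.
isDiv-scale : ∀ a d z → isDiv (d + a * suc d) (+[1+ a ] ℤ.* z) ≡ isDiv d z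
isDiv-scale a d z = does-⇔ (mk⇔ down up) (_ ∣ℤ? _) (_ ∣ℤ? _)
  where
  A = +[1+ a ]
  down : A ℤ.* +[1+ d ] ∣ℤ A ℤ.* z → +[1+ d ] ∣ℤ z
  down = ℤ∣.*-cancelˡ-∣ A
  up : +[1+ d ] ∣ℤ z → A ℤ.* +[1+ d ] ∣ℤ A ℤ.* z
  up = ℤ∣.*-monoʳ-∣ A

isDiv-shift : ∀ d k z → suc d ∣ℕ k → ∀ c → isDiv d (z ℤ.+ c ℤ.* + k) ≡ isDiv d z
isDiv-shift d k z d∣k c = does-⇔ (mk⇔ down up) (_ ∣ℤ? _) (_ ∣ℤ? _)
  where
  ck : +[1+ d ] ∣ℤ c ℤ.* + k
  ck = ℤ∣.∣n⇒∣m*n c (ℤ∣.∣ᵤ⇒∣ d∣k)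
  down : +[1+ d ] ∣ℤ z ℤ.+ c ℤ.* + k → +[1+ d ] ∣ℤ z
  down h = ℤ∣.∣m+n∣m⇒∣n (subst (+[1+ d ] ∣ℤ_) (ℤₚ.+-comm z _) h) ck
  up : +[1+ d ] ∣ℤ z → +[1+ d ] ∣ℤ z ℤ.+ c ℤ.* + k
  up h = ℤ∣.∣m∣n⇒∣m+n h ck

-- Substitutes the rational term s / (1 + a) for the first variable.
sub : ∀ {n} → ℕ → Lin n → QF (suc n) → QF n
sub a s (bool b)      = bool b
sub a s (pos (b ∷ l)) = pos (b · s ⊞ +[1+ a ] · l)
sub a s (dvd d (b ∷ l)) = dvd (d + a * suc d) (b · s ⊞ +[1+ a ] · l)
sub a s (neg θ)       = neg (sub a s θ)
sub a s (θ & η)       = sub a s θ & sub a s η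

ev-sub : ∀ {n} a (s : Lin n) b l ρ x → +[1+ a ] ℤ.* + x ≡ ev s ρ →
  ev (b · s ⊞ +[1+ a ] · l) ρ ≡ +[1+ a ] ℤ.* ev (b ∷ l) (extend x ρ)
ev-sub a s b l ρ x eq
  rewrite ev-⊞ (b · s) (+[1+ a ] · l) ρ | ev-· b s ρ | ev-· +[1+ a ] l ρ | sym eq
  = rearrange +[1+ a ] b (+ x) (ev l ρ)
  where
  rearrange : ∀ A b x t → b ℤ.* (A ℤ.* x) ℤ.+ A ℤ.* t ≡ A ℤ.* (b ℤ.* x ℤ.+ t)
  rearrange = solve-∀

⟦sub⟧ : ∀ {n} a (s : Lin n) θ ρ x → +[1+ a ] ℤ.* + x ≡ ev s ρ →
  ⟦ sub a s θ ⟧ ρ ≡ ⟦ θ ⟧ (extend x ρ)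
⟦sub⟧ a s (bool b)        ρ x eq = refl
⟦sub⟧ a s (pos (b ∷ l))   ρ x eq = trans (cong isPos (ev-sub a s b l ρ x eq)) (isPos-scale a (ev (b ∷ l) (extend x ρ)))
⟦sub⟧ a s (dvd d (b ∷ l)) ρ x eq =
  trans (cong (isDiv (d + a * suc d)) (ev-sub a s b l ρ x eq)) (isDiv-scale a d (ev (b ∷ l) (extend x ρ)))
⟦sub⟧ a s (neg θ)         ρ x eq = cong not (⟦sub⟧ a s θ ρ x eq)
⟦sub⟧ a s (θ & η)         ρ x eq = cong₂ _∧_ (⟦sub⟧ a s θ ρ x eq) (⟦sub⟧ a s η ρ x eq)

∧-true : ∀ {b c} → b ∧ c ≡ true → b ≡ true × c ≡ true
∧-true {true} eq = refl , eq

does-true : ∀ {P : Set} (P? : Dec P) → does P? ≡ true → P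
does-true (yes p) _ = p

does-false : ∀ {P : Set} (P? : Dec P) → does P? ≡ false → ¬ P
does-false (no ¬p) _ = ¬p

not-true : ∀ {b} → not b ≡ true → b ≡ false
not-true {false} _ = refl

-- The first two conjuncts say that `s / (1 + a)` is a natural number; only at such points does
-- `sub` have the intended meaning.
test : ∀ {n} → ℕ → Lin n → QF (suc n) → QF n
test a s θ = dvd a s & neg (pos (ℤ.- + 1 · s)) & sub a s θ

test-sound : ∀ {n} a (s : Lin n) θ ρ → ⟦ test a s θ ⟧ ρ ≡ true → ∃ λ x → ⟦ θ ⟧ (extend x ρ) ≡ true
test-sound a s θ ρ h
  with ∧-true h
... | h₁ , h₂₃ with ∧-true h₂₃
... | h₂ , h₃ with does-true (+[1+ a ] ∣ℤ? ev s ρ) h₁ | does-false (0ℤ ℤ.<? _) (not-true h₂)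
... | divides (+ x) eq | _ = x , trans (sym (⟦sub⟧ a s θ ρ x (trans (ℤₚ.*-comm +[1+ a ] (+ x)) (sym eq)))) h₃
... | divides -[1+ q ] eq | ¬pos = ⊥-elim (¬pos (subst (0ℤ ℤ.<_) (sym (trans (ev-· (ℤ.- + 1) s ρ) (cong (ℤ.- + 1 ℤ.*_) eq))) (ℤ.+<+ (s≤s z≤n))))

test-complete : ∀ {n} a (s : Lin n) θ ρ x → +[1+ a ] ℤ.* + x ≡ ev s ρ →
  ⟦ θ ⟧ (extend x ρ) ≡ true → ⟦ test a s θ ⟧ ρ ≡ true
test-complete a s θ ρ x eq h =
  cong₂ _∧_ (dec-true (+[1+ a ] ∣ℤ? ev s ρ) (divides (+ x) (trans (sym eq) (ℤₚ.*-comm +[1+ a ] (+ x)))))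
    (cong₂ _∧_ (cong not (dec-false (0ℤ ℤ.<? _) ¬pos)) (trans (⟦sub⟧ a s θ ρ x eq) h))
  where
  ¬pos : ¬ 0ℤ ℤ.< ev (ℤ.- + 1 · s) ρ
  ¬pos 0< rewrite ev-· (ℤ.- + 1) s ρ | sym eq | sym (ℤₚ.pos-* (suc a) x) with suc a * x | 0<
  ... | zero  | ℤ.+<+ ()
  ... | suc _ | ()

-- Elimination of one quantifier by finitely many test points

modulus : ∀ {n} → QF n → ℕ
modulus (bool b)  = 1
modulus (pos l)   = 1
modulus (dvd d l) = suc d
modulus (neg θ)   = modulus θ
modulus (θ & η)   = modulus θ * modulus η

modulus≢0 : ∀ {n} (θ : QF n) → NonZero (modulus θ)
modulus≢0 (bool b)  = _
modulus≢0 (pos l)   = _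
modulus≢0 (dvd d l) = _
modulus≢0 (neg θ)   = modulus≢0 θ
modulus≢0 (θ & η)   = ℕₚ.m*n≢0 (modulus θ) (modulus η) {{modulus≢0 θ}} {{modulus≢0 η}}

inequalities : ∀ {n} → QF (suc n) → List (ℤ × Lin n)
inequalities (bool b)      = []
inequalities (pos (b ∷ l)) = (b , l) ∷ []
inequalities (dvd d l)     = []
inequalities (neg θ)       = inequalities θ
inequalities (θ & η)       = inequalities θ ++ inequalities η

ev-shift : ∀ {n} b (l : Lin n) x D ρ →
  ev (b ∷ l) (extend (x + D) ρ) ≡ ev (b ∷ l) (extend x ρ) ℤ.+ b ℤ.* + D
ev-shift b l x D ρ rewrite ℤₚ.pos-+ x D = rearrange b (+ x) (+ D) (ev l ρ)
  where
  rearrange : ∀ b x D t → b ℤ.* (x ℤ.+ D) ℤ.+ t ≡ b ℤ.* x ℤ.+ t ℤ.+ b ℤ.* D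
  rearrange = solve-∀

Flips : ∀ {n} → Env n → ℕ → ℕ → ℤ × Lin n → Set
Flips ρ x D (b , l) = isPos (ev (b ∷ l) (extend (x + D) ρ)) ≢ isPos (ev (b ∷ l) (extend x ρ))

-- A multiple of every modulus leaves the divisibility atoms unchanged, so a change of truth value
-- is traced to one inequality. That inequality tells which list of test points to consult.
shift : ∀ {n} (θ : QF (suc n)) D → modulus θ ∣ℕ D → ∀ ρ x →
  ⟦ θ ⟧ (extend (x + D) ρ) ≡ ⟦ θ ⟧ (extend x ρ) ⊎ (∃ λ a → a ∈ inequalities θ × Flips ρ x D a)
shift (bool b) D m ρ x = inj₁ refl
shift (pos (b ∷ l)) D m ρ x
  with isPos (ev (b ∷ l) (extend (x + D) ρ)) ≟ᵇ isPos (ev (b ∷ l) (extend x ρ))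
... | yes eq = inj₁ eq
... | no neq = inj₂ ((b , l) , here refl , neq)
shift (dvd d (b ∷ l)) D m ρ x =
  inj₁ (trans (cong (isDiv d) (ev-shift b l x D ρ)) (isDiv-shift d D (ev (b ∷ l) (extend x ρ)) m b))
shift (neg θ) D m ρ x with shift θ D m ρ x
... | inj₁ eq = inj₁ (cong not eq)
... | inj₂ a  = inj₂ a
shift (θ & η) D m ρ x
  with shift θ D (ℕ∣.∣-trans (ℕ∣.m∣m*n (modulus η)) m) ρ x
     | shift η D (ℕ∣.∣-trans (ℕ∣.n∣m*n (modulus θ)) m) ρ x
... | inj₁ e | inj₁ f = inj₁ (cong₂ _∧_ e f)
... | inj₂ (a , a∈ , fl) | _ = inj₂ (a , ∈-++⁺ˡ a∈ , fl)
... | inj₁ _ | inj₂ (a , a∈ , fl) = inj₂ (a , ∈-++⁺ʳ (inequalities θ) a∈ , fl)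

∣∣-mono-nonNeg : ∀ {i j} → 0ℤ ℤ.≤ i → i ℤ.≤ j → ∣ i ∣ ≤ ∣ j ∣
∣∣-mono-nonNeg (ℤ.+≤+ _) (ℤ.+≤+ h) = h

-- Zero lies between `w` and `w + e`, so neither is farther from it than the length of the step.
flip-bound : ∀ w e → isPos (w ℤ.+ e) ≢ isPos w → ∣ w ℤ.+ e ∣ ≤ ∣ e ∣
flip-bound w e neq with 0ℤ ℤ.<? w ℤ.+ e | 0ℤ ℤ.<? w
... | yes p | yes q = ⊥-elim (neq refl)
... | no ¬p | no ¬q = ⊥-elim (neq refl)
... | yes p | no ¬q = ∣∣-mono-nonNeg (ℤₚ.<⇒≤ p)
  (subst (w ℤ.+ e ℤ.≤_) (ℤₚ.+-identityˡ e) (ℤₚ.+-monoˡ-≤ e (ℤₚ.≮⇒≥ ¬q)))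
... | no ¬p | yes q = subst₂ _≤_ (ℤₚ.∣-i∣≡∣i∣ (w ℤ.+ e)) (ℤₚ.∣-i∣≡∣i∣ e)
  (∣∣-mono-nonNeg (ℤₚ.neg-mono-≤ (ℤₚ.≮⇒≥ ¬p))
    (ℤₚ.neg-mono-≤ (subst (ℤ._≤ w ℤ.+ e) (ℤₚ.+-identityˡ e) (ℤₚ.+-monoˡ-≤ e (ℤₚ.<⇒≤ q)))))

interval : ℕ → List ℤ
interval J = map +_ (upTo (suc J)) ++ map (λ j → ℤ.- + j) (upTo (suc J))

∈-interval : ∀ {J} z → ∣ z ∣ ≤ J → z ∈ interval J
∈-interval (+ n)    h = ∈-++⁺ˡ (∈-map⁺ +_ (∈-upTo⁺ (s≤s h)))
∈-interval {J} -[1+ n ] h = ∈-++⁺ʳ (map +_ (upTo (suc J))) (∈-map⁺ (λ j → ℤ.- + j) (∈-upTo⁺ (s≤s h)))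

-- If (b , l) flips at x + D then b (x + D) + l lies within |b| D of 0.
flipPoints : ∀ {n} → ℕ → QF (suc n) → ℤ × Lin n → List (QF n)
flipPoints D θ (+ 0      , l) = []
flipPoints D θ (+[1+ a ] , l) = map (λ j → test a (const j ⊞ ℤ.- + 1 · l) θ) (interval (suc a * D))
flipPoints D θ (-[1+ a ] , l) = map (λ j → test a (l ⊞ const (ℤ.- j)) θ) (interval (suc a * D))

-- A satisfying x can be lowered by the modulus m until it is below m or an inequality flips.
testPoints : ∀ {n} → QF (suc n) → List (QF n)
testPoints θ = map (λ j → test 0 (const (+ j)) θ) (upTo (modulus θ))
  ++ concatMap (flipPoints (modulus θ) θ) (inequalities θ)

some : ∀ {n} → List (QF n) → QF n
some []       = bool false
some (θ ∷ θs) = neg (neg θ & neg (some θs))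

some-complete : ∀ {n} {ρ : Env n} {θ θs} → θ ∈ θs → ⟦ θ ⟧ ρ ≡ true → ⟦ some θs ⟧ ρ ≡ true
some-complete (here refl) h rewrite h = refl
some-complete {ρ = ρ} {θs = η ∷ θs} (there m) h rewrite some-complete {ρ = ρ} m h with ⟦ η ⟧ ρ
... | true  = refl
... | false = refl

some-sound : ∀ {n} {ρ : Env n} θs → ⟦ some θs ⟧ ρ ≡ true → ∃ λ θ → θ ∈ θs × ⟦ θ ⟧ ρ ≡ true
some-sound {ρ = ρ} (θ ∷ θs) h with ⟦ θ ⟧ ρ in eq
... | true  = θ , here refl , eq
... | false with some-sound θs (trans (sym (not-not _)) h)
  where
  not-not : ∀ b → not (not b) ≡ b
  not-not true  = refl
  not-not false = refl
... | η , m , h′ = η , there m , h′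

elim : ∀ {n} → QF (suc n) → QF n
elim θ = some (testPoints θ)

testPoints-sound : ∀ {n} (θ : QF (suc n)) ρ η → η ∈ testPoints θ → ⟦ η ⟧ ρ ≡ true →
  ∃ λ x → ⟦ θ ⟧ (extend x ρ) ≡ true
testPoints-sound θ ρ η m h with ∈-++⁻ (map (λ j → test 0 (const (+ j)) θ) (upTo (modulus θ))) m
... | inj₁ m₁ with ∈-map⁻ _ m₁
... | j , _ , refl = test-sound 0 (const (+ j)) θ ρ h
testPoints-sound θ ρ η m h | inj₂ m₂ with find (∈-concatMap⁻ (flipPoints (modulus θ) θ) {xs = inequalities θ} m₂)
... | a , _ , m₃ = flip a m₃
  where
  flip : ∀ a → η ∈ flipPoints (modulus θ) θ a → ∃ λ x → ⟦ θ ⟧ (extend x ρ) ≡ true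
  flip (+[1+ a ] , l) m with ∈-map⁻ _ {xs = interval (suc a * modulus θ)} m
  ... | j , _ , refl = test-sound a (const j ⊞ ℤ.- + 1 · l) θ ρ h
  flip (-[1+ a ] , l) m with ∈-map⁻ _ {xs = interval (suc a * modulus θ)} m
  ... | j , _ , refl = test-sound a (l ⊞ const (ℤ.- j)) θ ρ h

flip-complete : ∀ {n} D (θ : QF (suc n)) ρ x a → Flips ρ x D a → ⟦ θ ⟧ (extend (x + D) ρ) ≡ true →
  ∃ λ η → η ∈ flipPoints D θ a × ⟦ η ⟧ ρ ≡ true
flip-complete D θ ρ x (b , l) fl h = point b value bound refl
  where
  v = ev (b ∷ l) (extend (x + D) ρ)
  w = ev (b ∷ l) (extend x ρ)
  value : v ≡ w ℤ.+ b ℤ.* + D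
  value = ev-shift b l x D ρ
  bound : ∣ v ∣ ≤ ∣ b ∣ * D
  bound = subst₂ _≤_ (cong ∣_∣ (sym value)) (ℤₚ.abs-* b (+ D))
    (flip-bound w (b ℤ.* + D) (λ eq → fl (trans (cong isPos value) eq)))
  neg1 : ∀ {n} (l : Lin n) ρ → ev (ℤ.- + 1 · l) ρ ≡ ℤ.- ev l ρ
  neg1 l ρ = trans (ev-· (ℤ.- + 1) l ρ) (ℤₚ.-1*i≡-i _)
  -- The satisfying point `x + D` is recovered from the value `v` of the flipping form: the
  -- numerator is `v - l` or `l - v`, according to the sign of the coefficient, so that the
  -- denominator stays positive.
  solve⁺ : ∀ A y t → A ℤ.* y ≡ (A ℤ.* y ℤ.+ t) ℤ.+ ℤ.- t
  solve⁺ = solve-∀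
  solve⁻ : ∀ A y t → A ℤ.* y ≡ t ℤ.+ ℤ.- ((ℤ.- A) ℤ.* y ℤ.+ t)
  solve⁻ = solve-∀
  point : ∀ c → v ≡ w ℤ.+ c ℤ.* + D → ∣ v ∣ ≤ ∣ c ∣ * D → c ≡ b →
    ∃ λ η → η ∈ flipPoints D θ (c , l) × ⟦ η ⟧ ρ ≡ true
  point (+ 0) eq bd refl = ⊥-elim (fl (cong isPos (trans eq (ℤₚ.+-identityʳ w))))
  point +[1+ a ] eq bd refl = _ , ∈-map⁺ _ (∈-interval v bd) ,
    test-complete a (const v ⊞ ℤ.- + 1 · l) θ ρ (x + D)
      (trans (solve⁺ +[1+ a ] (+ (x + D)) (ev l ρ))
        (sym (trans (ev-⊞ (const v) _ ρ) (cong₂ ℤ._+_ (ev-const v ρ) (neg1 l ρ))))) h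
  point -[1+ a ] eq bd refl = _ , ∈-map⁺ _ (∈-interval v bd) ,
    test-complete a (l ⊞ const (ℤ.- v)) θ ρ (x + D)
      (trans (solve⁻ +[1+ a ] (+ (x + D)) (ev l ρ))
        (sym (trans (ev-⊞ l _ ρ) (cong (λ z → ev l ρ ℤ.+ z) (ev-const (ℤ.- v) ρ))))) h

testPoints-complete : ∀ {n} (θ : QF (suc n)) ρ x → ⟦ θ ⟧ (extend x ρ) ≡ true →
  ∃ λ η → η ∈ testPoints θ × ⟦ η ⟧ ρ ≡ true
testPoints-complete θ ρ = <-rec _ step
  where
  m = modulus θ
  step : ∀ x → (∀ {y} → y < x → ⟦ θ ⟧ (extend y ρ) ≡ true → ∃ λ η → η ∈ testPoints θ × ⟦ η ⟧ ρ ≡ true) →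
    ⟦ θ ⟧ (extend x ρ) ≡ true → ∃ λ η → η ∈ testPoints θ × ⟦ η ⟧ ρ ≡ true
  step x rec h with x ℕ.<? m
  ... | yes x<m = _ , ∈-++⁺ˡ (∈-map⁺ _ (∈-upTo⁺ x<m)) ,
    test-complete 0 (const (+ x)) θ ρ x (trans (ℤₚ.*-identityˡ (+ x)) (sym (ev-const (+ x) ρ))) h
  ... | no x≮m = descend (x ∸ m) (ℕₚ.m∸n+n≡m (ℕₚ.≮⇒≥ x≮m))
    where
    descend : ∀ y → y + m ≡ x → ∃ λ η → η ∈ testPoints θ × ⟦ η ⟧ ρ ≡ true
    descend y refl with shift θ m ℕ∣.∣-refl ρ y
    ... | inj₁ eq = rec (ℕₚ.m<m+n y (ℕ.>-nonZero⁻¹ m {{modulus≢0 θ}})) (trans (sym eq) h)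
    ... | inj₂ (a , a∈ , fl) with flip-complete m θ ρ y a fl h
    ... | η , η∈ , hη = η , ∈-++⁺ʳ (map (λ j → test 0 (const (+ j)) θ) (upTo m))
      (∈-concatMap⁺ (flipPoints m θ) (lose a∈ η∈)) , hη

elim-correct : ∀ {n} (θ : QF (suc n)) ρ → (∃ λ x → ⟦ θ ⟧ (extend x ρ) ≡ true) ⇔ ⟦ elim θ ⟧ ρ ≡ true
elim-correct θ ρ = mk⇔ complete sound
  where
  complete : (∃ λ x → ⟦ θ ⟧ (extend x ρ) ≡ true) → ⟦ elim θ ⟧ ρ ≡ true
  complete (x , h) with testPoints-complete θ ρ x h
  ... | η , m , hη = some-complete m hη
  sound : ⟦ elim θ ⟧ ρ ≡ true → ∃ λ x → ⟦ θ ⟧ (extend x ρ) ≡ true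
  sound h with some-sound (testPoints θ) h
  ... | η , m , hη = testPoints-sound θ ρ η m hη

-- Elimination for arbitrary formulas

term : ∀ {n} → Term n → Lin n
term (var i)  = varˡ i
term (s ⊕ₜ t) = term s ⊞ term t

ev-term : ∀ {n} (t : Term n) ρ → ev (term t) ρ ≡ + evalT ℕStr t ρ
ev-term (var i)  ρ = ev-var i ρ
ev-term (s ⊕ₜ t) ρ = trans (ev-⊞ (term s) (term t) ρ) (cong₂ ℤ._+_ (ev-term s ρ) (ev-term t ρ))

_⊑_ : ∀ {n} → Lin n → Lin n → QF n
s ⊑ t = neg (pos (s ⊞ ℤ.- + 1 · t))

qe : ∀ {n} → Formula n → QF n
qe (s ≐ t)  = term s ⊑ term t & term t ⊑ term s
qe ⊤'       = bool true
qe ⊥'       = bool false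
qe (¬' φ)   = neg (qe φ)
qe (φ ∧' ψ) = qe φ & qe ψ
qe (φ ∨' ψ) = neg (neg (qe φ) & neg (qe ψ))
qe (φ ⇒' ψ) = neg (qe φ & neg (qe ψ))
qe (∀' φ)   = neg (elim (neg (qe φ)))
qe (∃' φ)   = elim (qe φ)

⊑-correct : ∀ {n} (s t : Term n) ρ →
  evalT ℕStr s ρ ≤ evalT ℕStr t ρ ⇔ ⟦ term s ⊑ term t ⟧ ρ ≡ true
⊑-correct s t ρ = mk⇔
  (λ le → cong not (dec-false (0ℤ ℤ.<? _) (λ p → ℤₚ.<⇒≱ p (subst (ℤ._≤ 0ℤ) (sym value) (ℤₚ.i≤j⇒i-j≤0 (ℤ.+≤+ le))))))
  (λ h → drop (ℤₚ.i-j≤0⇒i≤j (subst (ℤ._≤ 0ℤ) value (ℤₚ.≮⇒≥ (does-false (0ℤ ℤ.<? _) (not-true h))))))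
  where
  drop : ∀ {m n} → + m ℤ.≤ + n → m ≤ n
  drop (ℤ.+≤+ le) = le
  value : ev (term s ⊞ ℤ.- + 1 · term t) ρ ≡ + evalT ℕStr s ρ ℤ.- + evalT ℕStr t ρ
  value = trans (ev-⊞ (term s) _ ρ) (cong₂ ℤ._+_ (ev-term s ρ)
    (trans (ev-· (ℤ.- + 1) (term t) ρ) (trans (ℤₚ.-1*i≡-i _) (cong ℤ.-_ (ev-term t ρ)))))

not-false : ∀ {b} → b ≢ true → not b ≡ true
not-false {true}  h = ⊥-elim (h refl)
not-false {false} h = refl

true≢not-true : ∀ {b} → not b ≡ true → b ≢ true
true≢not-true {false} _ ()

-- Disjunction, implication and `∀'` are compiled through double negations, while satisfaction is
-- constructive. Returning from the Boolean value therefore needs decidability of immediate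
-- subformulas, which is their own case of this correctness; hence the mutual recursion with `sat?`.
qe-correct : ∀ {n} (φ : Formula n) ρ → ℕ⊨ φ ρ ⇔ ⟦ qe φ ⟧ ρ ≡ true

sat? : ∀ {n} (φ : Formula n) ρ → Dec (ℕ⊨ φ ρ)
sat? φ ρ = map′ (from (qe-correct φ ρ)) (to (qe-correct φ ρ)) (⟦ qe φ ⟧ ρ ≟ᵇ true)

qe-correct (s ≐ t) ρ = mk⇔
  (λ eq → cong₂ _∧_ (to (⊑-correct s t ρ) (ℕₚ.≤-reflexive eq)) (to (⊑-correct t s ρ) (ℕₚ.≤-reflexive (sym eq))))
  (λ h → ℕₚ.≤-antisym (from (⊑-correct s t ρ) (proj₁ (∧-true h))) (from (⊑-correct t s ρ) (proj₂ (∧-true h))))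
qe-correct ⊤' ρ = mk⇔ (λ _ → refl) (λ _ → tt)
qe-correct ⊥' ρ = mk⇔ (λ ()) (λ ())
qe-correct (¬' φ) ρ = mk⇔
  (λ h → not-false (h ∘ from (qe-correct φ ρ)))
  (λ h → true≢not-true h ∘ to (qe-correct φ ρ))
qe-correct (φ ∧' ψ) ρ = mk⇔
  (λ { (p , q) → cong₂ _∧_ (to (qe-correct φ ρ) p) (to (qe-correct ψ ρ) q) })
  (λ h → from (qe-correct φ ρ) (proj₁ (∧-true h)) , from (qe-correct ψ ρ) (proj₂ (∧-true h)))
qe-correct (φ ∨' ψ) ρ = mk⇔ fwd bwd
  where
  fwd : ℕ⊨ φ ρ ⊎ ℕ⊨ ψ ρ → ⟦ qe (φ ∨' ψ) ⟧ ρ ≡ true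
  fwd h = not-false λ e → true≢not-true (proj₁ (∧-true e)) (to (qe-correct φ ρ)
    (case h e))
    where
    case : ℕ⊨ φ ρ ⊎ ℕ⊨ ψ ρ → _ → ℕ⊨ φ ρ
    case (inj₁ p) _ = p
    case (inj₂ q) e = ⊥-elim (true≢not-true (proj₂ (∧-true {not (⟦ qe φ ⟧ ρ)} e)) (to (qe-correct ψ ρ) q))
  bwd : ⟦ qe (φ ∨' ψ) ⟧ ρ ≡ true → ℕ⊨ φ ρ ⊎ ℕ⊨ ψ ρ
  bwd h with sat? φ ρ | sat? ψ ρ
  ... | yes p | _     = inj₁ p
  ... | no _  | yes q = inj₂ q
  ... | no ¬p | no ¬q = ⊥-elim (true≢not-true h
    (cong₂ _∧_ (not-false (¬p ∘ from (qe-correct φ ρ))) (not-false (¬q ∘ from (qe-correct ψ ρ)))))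
qe-correct (φ ⇒' ψ) ρ = mk⇔
  (λ h → not-false λ e → true≢not-true (proj₂ (∧-true {⟦ qe φ ⟧ ρ} e))
    (to (qe-correct ψ ρ) (h (from (qe-correct φ ρ) (proj₁ (∧-true e))))))
  bwd
  where
  bwd : ⟦ qe (φ ⇒' ψ) ⟧ ρ ≡ true → ℕ⊨ φ ρ → ℕ⊨ ψ ρ
  bwd h p with sat? ψ ρ
  ... | yes q = q
  ... | no ¬q = ⊥-elim (true≢not-true h
    (cong₂ _∧_ (to (qe-correct φ ρ) p) (not-false (¬q ∘ from (qe-correct ψ ρ)))))
qe-correct (∀' φ) ρ = mk⇔
  (λ h → not-false λ e → let (x , hx) = from (elim-correct (neg (qe φ)) ρ) e in
    true≢not-true hx (to (qe-correct φ (extend x ρ)) (h x)))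
  bwd
  where
  bwd : ⟦ qe (∀' φ) ⟧ ρ ≡ true → ∀ x → ℕ⊨ φ (extend x ρ)
  bwd h x with sat? φ (extend x ρ)
  ... | yes p = p
  ... | no ¬p = ⊥-elim (true≢not-true h
    (to (elim-correct (neg (qe φ)) ρ) (x , not-false (¬p ∘ from (qe-correct φ (extend x ρ))))))
qe-correct (∃' φ) ρ = mk⇔
  (λ { (x , p) → to (elim-correct (qe φ) ρ) (x , to (qe-correct φ (extend x ρ)) p) })
  (λ h → let (x , p) = from (elim-correct (qe φ) ρ) h in x , from (qe-correct φ (extend x ρ)) p)

-- Eventual periodicity along the lines y = x + q

isPos-eventually-constant : ∀ k c → ∃ λ N → ∀ x → N ≤ x →
  isPos (k ℤ.* + x ℤ.+ c) ≡ isPos (k ℤ.* + N ℤ.+ c)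
isPos-eventually-constant (+ 0)    c = 0 , λ x _ → refl
-- Strict positivity needs `x` to exceed `∣ c ∣`; for a negative slope `x ≥ ∣ c ∣` already makes the
-- value nonpositive.
isPos-eventually-constant +[1+ k ] c = suc ∣ c ∣ , λ x N≤x → trans (positive x N≤x) (sym (positive _ ℕₚ.≤-refl))
  where
  positive : ∀ x → ∣ c ∣ < x → isPos (+[1+ k ] ℤ.* + x ℤ.+ c) ≡ true
  positive x c<x = dec-true (0ℤ ℤ.<? _) (ℤₚ.<-≤-trans (pos+ c c<x) (ℤₚ.+-monoˡ-≤ c
    (subst (+ x ℤ.≤_) (ℤₚ.pos-* (suc k) x) (ℤ.+≤+ (ℕₚ.m≤m+n x (k * x))))))
    where
    pos+ : ∀ c → ∣ c ∣ < x → 0ℤ ℤ.< + x ℤ.+ c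
    pos+ (+ c)    lt = ℤ.+<+ (ℕₚ.<-≤-trans (ℕₚ.≤-<-trans z≤n lt) (ℕₚ.m≤m+n x c))
    pos+ -[1+ c ] lt = subst (0ℤ ℤ.<_) (sym (ℤₚ.⊖-≥ (ℕₚ.<⇒≤ lt))) (ℤ.+<+ (ℕₚ.m<n⇒0<n∸m lt))
isPos-eventually-constant -[1+ k ] c = ∣ c ∣ , λ x N≤x → trans (nonpositive x N≤x) (sym (nonpositive _ ℕₚ.≤-refl))
  where
  nonpositive : ∀ x → ∣ c ∣ ≤ x → isPos (-[1+ k ] ℤ.* + x ℤ.+ c) ≡ false
  nonpositive x c≤x = dec-false (0ℤ ℤ.<? _) (ℤₚ.≤⇒≯ (subst (-[1+ k ] ℤ.* + x ℤ.+ c ℤ.≤_)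
    (ℤₚ.+-inverseˡ (+[1+ k ] ℤ.* + x)) (subst (ℤ._≤ _) (cong (ℤ._+ c) (ℤₚ.neg-distribˡ-* +[1+ k ] (+ x)))
      (ℤₚ.+-monoʳ-≤ (ℤ.- (+[1+ k ] ℤ.* + x)) bound))))
    where
    below : ∀ c → c ℤ.≤ + ∣ c ∣
    below (+ c)    = ℤₚ.≤-refl
    below -[1+ c ] = ℤ.-≤+
    bound : c ℤ.≤ +[1+ k ] ℤ.* + x
    bound = ℤₚ.≤-trans (below c) (subst (+ ∣ c ∣ ℤ.≤_) (ℤₚ.pos-* (suc k) x)
      (ℤ.+≤+ (ℕₚ.≤-trans c≤x (ℕₚ.m≤m+n x (k * x)))))

-- On the line `y = x + q` a linear form depends linearly on `x` alone. Its sign is eventually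
-- constant, and its residues repeat because `q` is a multiple of the moduli.
qf-periodic : ∀ (θ : QF 2) q → modulus θ ∣ℕ q →
  ∃ λ N → ∀ x → N ≤ x → ⟦ θ ⟧ (env2 x (x + q)) ≡ ⟦ θ ⟧ (env2 (x + q) (x + q + q))
qf-periodic (bool b) q m = 0 , λ x _ → refl
qf-periodic (pos (b ∷ b′ ∷ con c)) q m with isPos-eventually-constant (b ℤ.+ b′) (b′ ℤ.* + q ℤ.+ c)
... | N , const-from-N = N , λ x N≤x → trans (cong isPos (collect x)) (trans (const-from-N x N≤x)
  (sym (trans (cong isPos (collect (x + q))) (const-from-N (x + q) (ℕₚ.≤-trans N≤x (ℕₚ.m≤m+n x q))))))
  where
  collectℤ : ∀ b b′ x q c → b ℤ.* x ℤ.+ (b′ ℤ.* (x ℤ.+ q) ℤ.+ c) ≡ (b ℤ.+ b′) ℤ.* x ℤ.+ (b′ ℤ.* q ℤ.+ c)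
  collectℤ = solve-∀
  collect : ∀ x → b ℤ.* + x ℤ.+ (b′ ℤ.* + (x + q) ℤ.+ c) ≡ (b ℤ.+ b′) ℤ.* + x ℤ.+ (b′ ℤ.* + q ℤ.+ c)
  collect x = trans (cong (λ z → b ℤ.* + x ℤ.+ (b′ ℤ.* z ℤ.+ c)) (ℤₚ.pos-+ x q)) (collectℤ b b′ (+ x) (+ q) c)
qf-periodic (dvd d l@(b ∷ b′ ∷ con c)) q m = 0 , λ x _ →
  sym (trans (cong (isDiv d) (collect x)) (isDiv-shift d q (ev l (env2 x (x + q))) m (b ℤ.+ b′)))
  where
  collectℤ : ∀ b b′ x y q c → b ℤ.* (x ℤ.+ q) ℤ.+ (b′ ℤ.* (y ℤ.+ q) ℤ.+ c)
    ≡ b ℤ.* x ℤ.+ (b′ ℤ.* y ℤ.+ c) ℤ.+ (b ℤ.+ b′) ℤ.* q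
  collectℤ = solve-∀
  collect : ∀ x → b ℤ.* + (x + q) ℤ.+ (b′ ℤ.* + (x + q + q) ℤ.+ c)
    ≡ b ℤ.* + x ℤ.+ (b′ ℤ.* + (x + q) ℤ.+ c) ℤ.+ (b ℤ.+ b′) ℤ.* + q
  collect x = trans (cong₂ (λ y z → b ℤ.* y ℤ.+ (b′ ℤ.* z ℤ.+ c)) (ℤₚ.pos-+ x q) (ℤₚ.pos-+ (x + q) q))
    (collectℤ b b′ (+ x) (+ (x + q)) (+ q) c)
qf-periodic (neg θ) q m with qf-periodic θ q m
... | N , h = N , λ x N≤x → cong not (h x N≤x)
qf-periodic (θ & η) q m
  with qf-periodic θ q (ℕ∣.∣-trans (ℕ∣.m∣m*n (modulus η)) m)
     | qf-periodic η q (ℕ∣.∣-trans (ℕ∣.n∣m*n (modulus θ)) m)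
... | N , h | M , k = N ℕ.⊔ M , λ x le → cong₂ _∧_
  (h x (ℕₚ.≤-trans (ℕₚ.m≤m⊔n N M) le)) (k x (ℕₚ.≤-trans (ℕₚ.m≤n⊔m N M) le))

-- Definable predicates

lift : ∀ {m n} → (Fin m → Fin n) → Fin (suc m) → Fin (suc n)
lift f zero    = zero
lift f (suc i) = suc (f i)

renameT : ∀ {m n} → (Fin m → Fin n) → Term m → Term n
renameT f (var i)  = var (f i)
renameT f (s ⊕ₜ t) = renameT f s ⊕ₜ renameT f t

rename : ∀ {m n} → (Fin m → Fin n) → Formula m → Formula n
rename f (s ≐ t)  = renameT f s ≐ renameT f t
rename f ⊤'       = ⊤'
rename f ⊥'       = ⊥'
rename f (¬' φ)   = ¬' rename f φ
rename f (φ ∧' ψ) = rename f φ ∧' rename f ψ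
rename f (φ ∨' ψ) = rename f φ ∨' rename f ψ
rename f (φ ⇒' ψ) = rename f φ ⇒' rename f ψ
rename f (∀' φ)   = ∀' rename (lift f) φ
rename f (∃' φ)   = ∃' rename (lift f) φ

evalT-rename : ∀ {m n} (f : Fin m → Fin n) {ρ : Env n} {σ : Env m} → (∀ i → ρ (f i) ≡ σ i) →
  ∀ t → evalT ℕStr (renameT f t) ρ ≡ evalT ℕStr t σ
evalT-rename f h (var i)  = h i
evalT-rename f h (s ⊕ₜ t) = cong₂ _+_ (evalT-rename f h s) (evalT-rename f h t)

lift-extend : ∀ {m n} (f : Fin m → Fin n) {ρ : Env n} {σ : Env m} → (∀ i → ρ (f i) ≡ σ i) →
  ∀ x i → extend x ρ (lift f i) ≡ extend x σ i
lift-extend f h x zero    = refl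
lift-extend f h x (suc i) = h i

-- Environments agree pointwise rather than as functions: `extend x ρ ∘ lift f` and `extend x σ` are
-- only pointwise equal, and this is what passes under a quantifier.
sat-rename : ∀ {m n} (f : Fin m → Fin n) {ρ : Env n} {σ : Env m} → (∀ i → ρ (f i) ≡ σ i) →
  ∀ φ → ℕ⊨ (rename f φ) ρ ⇔ ℕ⊨ φ σ
sat-rename f h (s ≐ t) = mk⇔
  (λ eq → trans (sym (evalT-rename f h s)) (trans eq (evalT-rename f h t)))
  (λ eq → trans (evalT-rename f h s) (trans eq (sym (evalT-rename f h t))))
sat-rename f h ⊤' = ⇔-id _
sat-rename f h ⊥' = ⇔-id _
sat-rename f h (¬' φ) = mk⇔ (_∘ from (sat-rename f h φ)) (_∘ to (sat-rename f h φ))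
sat-rename f h (φ ∧' ψ) = mk⇔
  (λ { (p , q) → to (sat-rename f h φ) p , to (sat-rename f h ψ) q })
  (λ { (p , q) → from (sat-rename f h φ) p , from (sat-rename f h ψ) q })
sat-rename f h (φ ∨' ψ) = mk⇔
  (λ { (inj₁ p) → inj₁ (to (sat-rename f h φ) p) ; (inj₂ q) → inj₂ (to (sat-rename f h ψ) q) })
  (λ { (inj₁ p) → inj₁ (from (sat-rename f h φ) p) ; (inj₂ q) → inj₂ (from (sat-rename f h ψ) q) })
sat-rename f h (φ ⇒' ψ) = mk⇔
  (λ k → to (sat-rename f h ψ) ∘ k ∘ from (sat-rename f h φ))
  (λ k → from (sat-rename f h ψ) ∘ k ∘ to (sat-rename f h φ))
sat-rename f h (∀' φ) = mk⇔
  (λ k x → to (sat-rename (lift f) (lift-extend f h x) φ) (k x))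
  (λ k x → from (sat-rename (lift f) (lift-extend f h x) φ) (k x))
sat-rename f h (∃' φ) = mk⇔
  (λ { (x , p) → x , to (sat-rename (lift f) (lift-extend f h x) φ) p })
  (λ { (x , p) → x , from (sat-rename (lift f) (lift-extend f h x) φ) p })

record Definable {n : ℕ} (P : Env n → Set) : Set where
  constructor _by_
  field
    formula : Formula n
    correct : ∀ ρ → ℕ⊨ formula ρ ⇔ P ρ
open Definable

infixr 3 _×ᵈ_
infixr 2 _→ᵈ_

opaque
  decide : ∀ {n} {P : Env n → Set} → Definable P → ∀ ρ → Dec (P ρ)
  decide d ρ = map′ (to (correct d ρ)) (from (correct d ρ)) (sat? (formula d) ρ)

respᵈ : ∀ {n} {P Q : Env n → Set} → (∀ ρ → P ρ ⇔ Q ρ) → Definable P → Definable Q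
respᵈ e d = formula d by λ ρ → e ρ ⇔-∘ correct d ρ

renameᵈ : ∀ {m n} {P : Env m → Set} (f : Fin m → Fin n) → Definable P → Definable (λ ρ → P (ρ ∘ f))
renameᵈ f d = rename f (formula d) by λ ρ →
  correct d (ρ ∘ f) ⇔-∘ sat-rename f (λ _ → refl) (formula d)

at₁ : ∀ {n} {P : Env 1 → Set} (i : Fin n) → Definable P → Definable (λ ρ → P (ρ ∘ extend i empty))
at₁ i = renameᵈ (extend i empty)

at₂ : ∀ {n} {P : Env 2 → Set} (i j : Fin n) → Definable P →
  Definable (λ ρ → P (ρ ∘ extend i (extend j empty)))
at₂ i j = renameᵈ (extend i (extend j empty))

at₃ : ∀ {n} {P : Env 3 → Set} (i j k : Fin n) → Definable P →
  Definable (λ ρ → P (ρ ∘ extend i (extend j (extend k empty))))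
at₃ i j k = renameᵈ (extend i (extend j (extend k empty)))

_×ᵈ_ : ∀ {n} {P Q : Env n → Set} → Definable P → Definable Q → Definable (λ ρ → P ρ × Q ρ)
d ×ᵈ e = (formula d ∧' formula e) by λ ρ → mk⇔
  (λ { (p , q) → to (correct d ρ) p , to (correct e ρ) q })
  (λ { (p , q) → from (correct d ρ) p , from (correct e ρ) q })

_→ᵈ_ : ∀ {n} {P Q : Env n → Set} → Definable P → Definable Q → Definable (λ ρ → P ρ → Q ρ)
d →ᵈ e = (formula d ⇒' formula e) by λ ρ → mk⇔
  (λ k → to (correct e ρ) ∘ k ∘ from (correct d ρ))
  (λ k → from (correct e ρ) ∘ k ∘ to (correct d ρ))

¬ᵈ_ : ∀ {n} {P : Env n → Set} → Definable P → Definable (λ ρ → ¬ P ρ)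
¬ᵈ d = (¬' formula d) by λ ρ → mk⇔ (_∘ from (correct d ρ)) (_∘ to (correct d ρ))

∃ᵈ : ∀ {n} {P : Env n → ℕ → Set} → Definable {suc n} (λ ρ → P (ρ ∘ suc) (ρ zero)) →
  Definable (λ ρ → ∃ (P ρ))
∃ᵈ d = (∃' formula d) by λ ρ → mk⇔
  (λ { (x , p) → x , to (correct d (extend x ρ)) p })
  (λ { (x , p) → x , from (correct d (extend x ρ)) p })

∀ᵈ : ∀ {n} {P : Env n → ℕ → Set} → Definable {suc n} (λ ρ → P (ρ ∘ suc) (ρ zero)) →
  Definable (λ ρ → ∀ x → P ρ x)
∀ᵈ d = (∀' formula d) by λ ρ → mk⇔
  (λ k x → to (correct d (extend x ρ)) (k x))
  (λ k x → from (correct d (extend x ρ)) (k x))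

equal : ∀ {n} (i j : Fin n) → Definable (λ ρ → ρ i ≡ ρ j)
equal i j = (var i ≐ var j) by λ ρ → ⇔-id _

plus : ∀ {n} (i j k : Fin n) → Definable (λ ρ → ρ i ≡ ρ j + ρ k)
plus i j k = (var i ≐ (var j ⊕ₜ var k)) by λ ρ → ⇔-id _

leq : ∀ {n} (i j : Fin n) → Definable (λ ρ → ρ i ≤ ρ j)
leq i j = respᵈ
  (λ ρ → mk⇔ (λ { (z , eq) → subst (ρ i ≤_) (sym eq) (ℕₚ.m≤m+n (ρ i) z) })
             (λ le → ρ j ∸ ρ i , sym (ℕₚ.m+[n∸m]≡n le)))
  (∃ᵈ {P = λ ρ z → ρ j ≡ ρ i + z} (plus (suc j) (suc i) zero))

less : ∀ {n} (i j : Fin n) → Definable (λ ρ → ρ i < ρ j)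
less i j = respᵈ (λ ρ → mk⇔ (λ { (le , ne) → ℕₚ.≤∧≢⇒< le ne }) (λ lt → ℕₚ.<⇒≤ lt , ℕₚ.<⇒≢ lt))
  (leq i j ×ᵈ ¬ᵈ equal i j)

-- The signature has no constants: 0 is the solution of `x = x + x`, 1 the least nonzero number, and
-- further numerals are built by adding 1.
isZero : ∀ {n} (i : Fin n) → Definable (λ ρ → ρ i ≡ 0)
isZero i = respᵈ
  (λ ρ → mk⇔ (λ eq → ℕₚ.+-cancelˡ-≡ (ρ i) (ρ i) 0 (trans (sym eq) (sym (ℕₚ.+-identityʳ (ρ i)))))
             (λ eq → trans (sym (ℕₚ.+-identityʳ (ρ i))) (cong (λ w → ρ i + w) (sym eq))))
  (plus i i i)

isOne : ∀ {n} (i : Fin n) → Definable (λ ρ → ρ i ≡ 1)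
isOne i = respᵈ (λ ρ → mk⇔ (fwd (ρ i)) (bwd (ρ i)))
  (¬ᵈ isZero i ×ᵈ ∀ᵈ {P = λ ρ u → u < ρ i → u ≡ 0} (less zero (suc i) →ᵈ isZero zero))
  where
  fwd : ∀ x → (¬ x ≡ 0) × (∀ u → u < x → u ≡ 0) → x ≡ 1
  fwd zero          (x≢0 , _) = ⊥-elim (x≢0 refl)
  fwd (suc zero)    _         = refl
  fwd (suc (suc x)) (_ , h) with h 1 (s≤s (s≤s z≤n))
  ... | ()
  bwd : ∀ x → x ≡ 1 → (¬ x ≡ 0) × (∀ u → u < x → u ≡ 0)
  bwd _ refl = (λ ()) , λ { zero _ → refl ; (suc _) (s≤s ()) }

numeral : ∀ {n} c (i : Fin n) → Definable (λ ρ → ρ i ≡ c)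
numeral zero    i = isZero i
numeral (suc c) i = respᵈ
  (λ ρ → mk⇔ (λ { (u , v , u≡1 , v≡c , eq) → trans eq (cong₂ _+_ u≡1 v≡c) })
             (λ eq → 1 , c , refl , refl , eq))
  (∃ᵈ {P = λ ρ u → ∃ λ v → u ≡ 1 × v ≡ c × ρ i ≡ u + v}
    (∃ᵈ {P = λ ρ v → ρ zero ≡ 1 × v ≡ c × ρ (suc i) ≡ ρ zero + v}
      (isOne (suc zero) ×ᵈ numeral c zero ×ᵈ plus (suc (suc i)) (suc zero) zero)))

multiple : ∀ {n} k (i j : Fin n) → Definable (λ ρ → ρ i ≡ k * ρ j)
multiple zero    i j = isZero i
multiple (suc k) i j = respᵈ
  (λ ρ → mk⇔ (λ { (u , eq , eq′) → trans eq′ (cong (λ w → ρ j + w) eq) }) (λ eq → k * ρ j , refl , eq))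
  (∃ᵈ {P = λ ρ u → u ≡ k * ρ j × ρ i ≡ ρ j + u}
    (multiple k zero (suc j) ×ᵈ plus (suc i) (suc j) zero))

progression : ∀ {n} c p (i j : Fin n) → Definable (λ ρ → ρ i ≡ c + ρ j * p)
progression c p i j = respᵈ
  (λ ρ → mk⇔ (λ { (u , v , u≡c , v≡pk , eq) → trans eq (cong₂ _+_ u≡c (trans v≡pk (ℕₚ.*-comm p (ρ j)))) })
             (λ eq → c , p * ρ j , refl , refl , trans eq (cong (λ w → c + w) (ℕₚ.*-comm (ρ j) p))))
  (∃ᵈ {P = λ ρ u → ∃ λ v → u ≡ c × v ≡ p * ρ j × ρ i ≡ u + v}
    (∃ᵈ {P = λ ρ v → ρ zero ≡ c × v ≡ p * ρ (suc j) × ρ (suc i) ≡ ρ zero + v}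
      (numeral c (suc zero) ×ᵈ multiple p zero (suc (suc j)) ×ᵈ plus (suc (suc i)) (suc zero) zero)))

opaque
  -- All multiples of `p` are allowed as shifts, with a threshold depending on the shift, so that
  -- several definable predicates can be given a common one.
  periodic : ∀ {P : Env 2 → Set} → Definable P → ∃ λ p → NonZero p × (∀ q → p ∣ℕ q →
    ∃ λ N → ∀ x → N ≤ x → P (env2 x (x + q)) ⇔ P (env2 (x + q) (x + q + q)))
  periodic {P} d = modulus θ , modulus≢0 θ , λ q m → let (N , h) = qf-periodic θ q m in
    N , λ x N≤x → subst (λ b → (b ≡ true) ⇔ P (env2 (x + q) (x + q + q))) (sym (h x N≤x)) (truth _) ⇔-∘ ⇔-sym (truth _)
    where
    θ : QF 2
    θ = qe (formula d)
    truth : ∀ ρ → (⟦ θ ⟧ ρ ≡ true) ⇔ P ρ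
    truth ρ = correct d ρ ⇔-∘ ⇔-sym (qe-correct (formula d) ρ)

-- Consequences of Presburger arithmetic

module Model (A : Structure) (model : ModelOfPrA A) where

  open Structure A public using () renaming (Carrier to C; _⊕_ to infixl 6 _+ᴬ_)

  private
    x₀ : ∀ {n} → Term (suc n)
    x₀ = var zero
    x₁ : ∀ {n} → Term (suc (suc n))
    x₁ = var (suc zero)
    x₂ : ∀ {n} → Term (suc (suc (suc n)))
    x₂ = var (suc (suc zero))

    +-zeroᴬ : Σ C λ z → ∀ x → x +ᴬ z ≡ x
    +-zeroᴬ = model (∃' (∀' ((x₀ ⊕ₜ x₁) ≐ x₀))) (0 , ℕₚ.+-identityʳ)

  0ᴬ : C
  0ᴬ = proj₁ +-zeroᴬ

  +-identityʳ : ∀ x → x +ᴬ 0ᴬ ≡ x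
  +-identityʳ = proj₂ +-zeroᴬ

  +-comm : ∀ x y → x +ᴬ y ≡ y +ᴬ x
  +-comm = model (∀' (∀' ((x₁ ⊕ₜ x₀) ≐ (x₀ ⊕ₜ x₁)))) ℕₚ.+-comm

  +-assoc : ∀ x y z → (x +ᴬ y) +ᴬ z ≡ x +ᴬ (y +ᴬ z)
  +-assoc = model (∀' (∀' (∀' (((x₂ ⊕ₜ x₁) ⊕ₜ x₀) ≐ (x₂ ⊕ₜ (x₁ ⊕ₜ x₀)))))) ℕₚ.+-assoc

  +-cancelˡ : ∀ x y z → x +ᴬ y ≡ x +ᴬ z → y ≡ z
  +-cancelˡ = model (∀' (∀' (∀' (((x₂ ⊕ₜ x₁) ≐ (x₂ ⊕ₜ x₀)) ⇒' (x₁ ≐ x₀))))) ℕₚ.+-cancelˡ-≡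

  +-identityˡ : ∀ x → 0ᴬ +ᴬ x ≡ x
  +-identityˡ x = trans (+-comm 0ᴬ x) (+-identityʳ x)

  -- Every existential sentence yields its own witness, so sentences that speak of 0 name it by
  -- `x + x = x`; this lemma leads back to `0ᴬ`.
  idempotent⇒0 : ∀ x → x +ᴬ x ≡ x → x ≡ 0ᴬ
  idempotent⇒0 x eq = +-cancelˡ x x 0ᴬ (trans eq (sym (+-identityʳ x)))

  private
    nat-idempotent⇒0 : ∀ x → x + x ≡ x → x ≡ 0
    nat-idempotent⇒0 x eq = ℕₚ.+-cancelˡ-≡ x x 0 (trans eq (sym (ℕₚ.+-identityʳ x)))

    idempotent-summand : ∀ x y → (x +ᴬ y) +ᴬ (x +ᴬ y) ≡ x +ᴬ y → x +ᴬ x ≡ x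
    idempotent-summand = model
      (∀' (∀' ((((x₁ ⊕ₜ x₀) ⊕ₜ (x₁ ⊕ₜ x₀)) ≐ (x₁ ⊕ₜ x₀)) ⇒' ((x₁ ⊕ₜ x₁) ≐ x₁))))
      λ x y eq → let x≡0 = ℕₚ.m+n≡0⇒m≡0 x (nat-idempotent⇒0 (x + y) eq) in
        trans (cong (_+ x) x≡0) refl

    unit : Σ C λ o → (¬ o +ᴬ o ≡ o) × (∀ x → (x +ᴬ x ≡ x) ⊎ (Σ C λ y → x ≡ y +ᴬ o))
    unit = model
      (∃' ((¬' ((x₀ ⊕ₜ x₀) ≐ x₀)) ∧' (∀' (((x₀ ⊕ₜ x₀) ≐ x₀) ∨' (∃' (x₁ ≐ (x₀ ⊕ₜ x₂)))))))
      (1 , (λ ()) , λ { zero → inj₁ refl ; (suc x) → inj₂ (x , ℕₚ.+-comm 1 x) })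

  total : ∀ x y → Σ C λ d → (x +ᴬ d ≡ y) ⊎ (y +ᴬ d ≡ x)
  total = model (∀' (∀' (∃' (((x₂ ⊕ₜ x₀) ≐ x₁) ∨' ((x₁ ⊕ₜ x₀) ≐ x₂))))) nat-total
    where
    nat-total : ∀ x y → Σ ℕ λ d → (x + d ≡ y) ⊎ (y + d ≡ x)
    nat-total x y with ℕₚ.≤-total x y
    ... | inj₁ le = y ∸ x , inj₁ (ℕₚ.m+[n∸m]≡n le)
    ... | inj₂ le = x ∸ y , inj₂ (ℕₚ.m+[n∸m]≡n le)

  x+y≡0⇒x≡0 : ∀ x y → x +ᴬ y ≡ 0ᴬ → x ≡ 0ᴬ
  x+y≡0⇒x≡0 x y eq = idempotent⇒0 x (idempotent-summand x y
    (trans (cong₂ _+ᴬ_ eq eq) (trans (+-identityʳ 0ᴬ) (sym eq))))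

  1ᴬ : C
  1ᴬ = proj₁ unit

  1≢0 : ¬ 1ᴬ ≡ 0ᴬ
  1≢0 eq = proj₁ (proj₂ unit) (trans (cong (1ᴬ +ᴬ_) eq) (+-identityʳ 1ᴬ))

  zero-or-suc : ∀ x → (x ≡ 0ᴬ) ⊎ (Σ C λ y → x ≡ y +ᴬ 1ᴬ)
  zero-or-suc x with proj₂ (proj₂ unit) x
  ... | inj₁ eq = inj₁ (idempotent⇒0 x eq)
  ... | inj₂ s  = inj₂ s

  infix 4 _≤ᴬ_ _<ᴬ_
  _≤ᴬ_ _<ᴬ_ : C → C → Set
  x ≤ᴬ y = Σ C λ d → x +ᴬ d ≡ y
  x <ᴬ y = (¬ x ≡ y) × x ≤ᴬ y

  ≤-refl : ∀ {x} → x ≤ᴬ x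
  ≤-refl {x} = 0ᴬ , +-identityʳ x

  ≤-trans : ∀ {x y z} → x ≤ᴬ y → y ≤ᴬ z → x ≤ᴬ z
  ≤-trans {x} (d , refl) (e , refl) = d +ᴬ e , sym (+-assoc x d e)

  ≤-antisym : ∀ {x y} → x ≤ᴬ y → y ≤ᴬ x → x ≡ y
  ≤-antisym {x} (d , refl) (e , eq) =
    sym (trans (cong (x +ᴬ_) (x+y≡0⇒x≡0 d e (+-cancelˡ x (d +ᴬ e) 0ᴬ
      (trans (sym (+-assoc x d e)) (trans eq (sym (+-identityʳ x))))))) (+-identityʳ x))

  <-irrefl : ∀ {x} → ¬ x <ᴬ x
  <-irrefl (ne , _) = ne refl

  <-≤-trans : ∀ {x y z} → x <ᴬ y → y ≤ᴬ z → x <ᴬ z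
  <-≤-trans (ne , le) le′ = (λ { refl → ne (≤-antisym le le′) }) , ≤-trans le le′

  <-trans : ∀ {x y z} → x <ᴬ y → y <ᴬ z → x <ᴬ z
  <-trans lt (_ , le) = <-≤-trans lt le

  <-asym : ∀ {x y} → x <ᴬ y → ¬ y <ᴬ x
  <-asym lt lt′ = <-irrefl (<-trans lt lt′)

  +-monoʳ-< : ∀ z {x y} → x <ᴬ y → z +ᴬ x <ᴬ z +ᴬ y
  +-monoʳ-< z {x} {y} (ne , d , eq) = (λ e → ne (+-cancelˡ z x y e)) ,
    d , trans (+-assoc z x d) (cong (z +ᴬ_) eq)

  ≮0 : ∀ {x} → ¬ x <ᴬ 0ᴬ
  ≮0 {x} (ne , d , eq) = ne (x+y≡0⇒x≡0 x d eq)

  x<x+1 : ∀ x → x <ᴬ x +ᴬ 1ᴬ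
  x<x+1 x = (λ eq → 1≢0 (sym (+-cancelˡ x 0ᴬ 1ᴬ (trans (+-identityʳ x) eq)))) , 1ᴬ , refl

  -- Discreteness: the gap `d` is nonzero, hence of the form `e + 1`, and a unit cancels.
  <-suc⇒≤ : ∀ {x y} → x <ᴬ y +ᴬ 1ᴬ → x ≤ᴬ y
  <-suc⇒≤ {x} {y} (ne , d , eq) with zero-or-suc d
  ... | inj₁ refl = ⊥-elim (ne (trans (sym (+-identityʳ x)) eq))
  ... | inj₂ (e , refl) = e , +-cancelˡ 1ᴬ (x +ᴬ e) y
    (trans (+-comm 1ᴬ (x +ᴬ e)) (trans (+-assoc x e 1ᴬ) (trans eq (+-comm y 1ᴬ))))

  infixr 7 _×ᴬ_
  _×ᴬ_ : ℕ → C → C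
  zero  ×ᴬ b = 0ᴬ
  suc j ×ᴬ b = j ×ᴬ b +ᴬ b

  ×-homo-+ : ∀ m n b → (m + n) ×ᴬ b ≡ m ×ᴬ b +ᴬ n ×ᴬ b
  ×-homo-+ zero    n b = sym (+-identityˡ _)
  ×-homo-+ (suc m) n b = trans (cong (_+ᴬ b) (×-homo-+ m n b)) (trans (+-assoc _ _ b)
    (trans (cong (m ×ᴬ b +ᴬ_) (+-comm _ b)) (sym (+-assoc _ b _))))

  ×-mono-≤ : ∀ {m n} b → m ≤ n → m ×ᴬ b ≤ᴬ n ×ᴬ b
  ×-mono-≤ {m} {n} b le = (n ∸ m) ×ᴬ b ,
    trans (sym (×-homo-+ m (n ∸ m) b)) (cong (_×ᴬ b) (ℕₚ.m+[n∸m]≡n le))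

  numeralᴬ : ℕ → C
  numeralᴬ n = n ×ᴬ 1ᴬ

  numeral-mono-< : ∀ {m n} → m < n → numeralᴬ m <ᴬ numeralᴬ n
  numeral-mono-< {m} lt = <-≤-trans (x<x+1 (numeralᴬ m)) (×-mono-≤ 1ᴬ lt)

  numeral-injective : ∀ {m n} → numeralᴬ m ≡ numeralᴬ n → m ≡ n
  numeral-injective {m} {n} eq with ℕₚ.<-cmp m n
  ... | tri≈ _ m≡n _ = m≡n
  ... | tri< lt _ _  = ⊥-elim (proj₁ (numeral-mono-< lt) eq)
  ... | tri> _ _ gt  = ⊥-elim (proj₁ (numeral-mono-< gt) (sym eq))

  multiples-apart : ∀ {i j a c b} → i < j → a <ᴬ b → i ×ᴬ b +ᴬ a <ᴬ j ×ᴬ b +ᴬ c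
  multiples-apart {i} {j} {a} {c} {b} i<j a<b =
    <-≤-trans (+-monoʳ-< (i ×ᴬ b) a<b) (≤-trans (×-mono-≤ b i<j) (c , refl))

  -- With one number per element, equality of numbers takes the place of the equivalence `~`. The
  -- order need not be given, being definable from the graph of addition.
  record Coding : Set where
    field
      code          : C → ℕ
      code-injective : ∀ {a b} → code a ≡ code b → a ≡ b
      image-definable : Definable {1} (λ ρ → ∃ λ a → code a ≡ ρ zero)
      sum-definable   : Definable {3} (λ ρ → ∃ λ a → ∃ λ b →
        code (a +ᴬ b) ≡ ρ zero × code a ≡ ρ (suc zero) × code b ≡ ρ (suc (suc zero)))

-- Models coded by a definable subset of ℕ

search : ∀ {n} {P Q : Fin n → Set} → (∀ i → P i ⊎ Q i) → (∃ P) ⊎ (∀ i → Q i)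
search {zero}  f = inj₂ λ ()
search {suc n} f with f zero | search (f ∘ suc)
... | inj₁ p | _ = inj₁ (zero , p)
... | inj₂ q | inj₁ (i , p) = inj₁ (suc i , p)
... | inj₂ q | inj₂ qs = inj₂ λ { zero → q ; (suc i) → qs i }

uniform-bound : ∀ {n} {P : Fin n → ℕ → Set} → (∀ i {b c} → b ≤ c → P i b → P i c) →
  (∀ i → ∃ (P i)) → ∃ λ b → ∀ i → P i b
uniform-bound {zero}  mono f = 0 , λ ()
uniform-bound {suc n} mono f with f zero | uniform-bound (λ i → mono (suc i)) (f ∘ suc)
... | b , p | c , ps = b ⊔ c ,
  λ { zero → mono zero (ℕₚ.m≤m⊔n b c) p ; (suc i) → mono (suc i) (ℕₚ.m≤n⊔m b c) (ps i) }

chain : (_~_ : ℕ → ℕ → Set) → (∀ {x y z} → x ~ y → y ~ z → x ~ z) → ∀ (e : ℕ → ℕ) →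
  (∀ k → e k ~ e (suc k)) → ∀ k l → k < l → e k ~ e l
chain _~_ tr e step k (suc l) (s≤s k≤l) with ℕₚ.m≤n⇒m<n∨m≡n k≤l
... | inj₁ k<l  = tr (chain _~_ tr e step k l k<l) (step l)
... | inj₂ refl = step k

module Coded (A : Structure) (model : ModelOfPrA A) (coding : Model.Coding A model) where

  open Model A model
  open Coding coding

  _≟ᴬ_ : ∀ a b → Dec (a ≡ b)
  a ≟ᴬ b with code a ℕ.≟ code b
  ... | yes eq = yes (code-injective eq)
  ... | no ne  = no (ne ∘ cong code)

  compare : ∀ a b → a <ᴬ b ⊎ a ≡ b ⊎ b <ᴬ a
  compare a b with a ≟ᴬ b | total a b
  ... | yes eq | _ = inj₂ (inj₁ eq)
  ... | no ne  | d , inj₁ eq = inj₁ (ne , d , eq)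
  ... | no ne  | d , inj₂ eq = inj₂ (inj₂ (ne ∘ sym , d , eq))

  Image : ℕ → Set
  Image x = ∃ λ a → code a ≡ x

  Sum : ℕ → ℕ → ℕ → Set
  Sum x y z = ∃ λ a → ∃ λ b → code (a +ᴬ b) ≡ x × code a ≡ y × code b ≡ z

  infix 4 _≺_
  _≺_ : ℕ → ℕ → Set
  x ≺ y = ∃ λ a → ∃ λ b → code a ≡ x × code b ≡ y × a <ᴬ b

  opaque
    ≺-definable : Definable {2} (λ ρ → ρ zero ≺ ρ (suc zero))
    ≺-definable = respᵈ (λ ρ → mk⇔ (fwd (ρ zero) (ρ (suc zero))) (bwd (ρ zero) (ρ (suc zero))))
      (¬ᵈ equal zero (suc zero) ×ᵈ
       ∃ᵈ {P = λ ρ z → Sum (ρ (suc zero)) (ρ zero) z} (at₃ (suc (suc zero)) (suc zero) zero sum-definable))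
      where
      fwd : ∀ x y → (¬ x ≡ y) × (∃ λ z → Sum y x z) → x ≺ y
      fwd x y (ne , z , a , d , refl , refl , refl) = a , a +ᴬ d , refl , refl , ne ∘ cong code , d , refl
      bwd : ∀ x y → x ≺ y → (¬ x ≡ y) × (∃ λ z → Sum y x z)
      bwd x y (a , b , refl , refl , ne , d , refl) = ne ∘ code-injective , code d , a , d , refl , refl , refl

  ≺-code : ∀ {a b} → code a ≺ code b → a <ᴬ b
  ≺-code (a , b , ea , eb , lt) = subst₂ _<ᴬ_ (code-injective ea) (code-injective eb) lt

  ≺-trans : ∀ {x y z} → x ≺ y → y ≺ z → x ≺ z
  ≺-trans (a , b , refl , refl , lt) (c , d , ec , refl , lt′) =
    a , d , refl , refl , <-trans lt (subst (_<ᴬ d) (code-injective ec) lt′)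

  ≺-asym : ∀ {x y} → x ≺ y → ¬ y ≺ x
  ≺-asym (a , b , refl , refl , lt) h = <-asym lt (≺-code h)

  ≺-total : ∀ {x y} → Image x → Image y → ¬ x ≡ y → x ≺ y ⊎ y ≺ x
  ≺-total (a , refl) (b , refl) ne with compare a b
  ... | inj₁ lt = inj₁ (a , b , refl , refl , lt)
  ... | inj₂ (inj₁ refl) = ⊥-elim (ne refl)
  ... | inj₂ (inj₂ gt) = inj₂ (b , a , refl , refl , gt)

  image? : ∀ x → Dec (Image x)
  image? x = decide image-definable (env1 x)

  opaque
    periods : ∃ λ p → NonZero p × ∃ λ N →
      (∀ x → N ≤ x → Image x ⇔ Image (x + p)) × (∀ x → N ≤ x → x ≺ x + p ⇔ x + p ≺ x + p + p)
    -- The image is treated as a binary predicate that ignores its second variable; the product of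
    -- the two periods is a legitimate shift for both predicates.
    periods with periodic (at₁ zero image-definable) | periodic ≺-definable
    ... | p₁ , p₁≢0 , tail₁ | p₂ , p₂≢0 , tail₂
      with tail₁ (p₁ * p₂) (ℕ∣.m∣m*n p₂) | tail₂ (p₁ * p₂) (ℕ∣.n∣m*n p₁)
    ... | N₁ , h₁ | N₂ , h₂ = p₁ * p₂ , ℕₚ.m*n≢0 p₁ p₂ {{p₁≢0}} {{p₂≢0}} , N₁ ⊔ N₂ ,
      (λ x le → h₁ x (ℕₚ.≤-trans (ℕₚ.m≤m⊔n N₁ N₂) le)) , (λ x le → h₂ x (ℕₚ.≤-trans (ℕₚ.m≤n⊔m N₁ N₂) le))

  p N : ℕ
  p = proj₁ periods
  N = proj₁ (proj₂ (proj₂ periods))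

  instance
    p≢0 : NonZero p
    p≢0 = proj₁ (proj₂ periods)

  image-periodic : ∀ x → N ≤ x → Image x ⇔ Image (x + p)
  image-periodic = proj₁ (proj₂ (proj₂ (proj₂ periods)))

  ≺-periodic : ∀ x → N ≤ x → x ≺ x + p ⇔ x + p ≺ x + p + p
  ≺-periodic = proj₂ (proj₂ (proj₂ (proj₂ periods)))

  -- Residue classes modulo `p` beyond `N`

  elt : ℕ → ℕ → ℕ
  elt i k = i + k * p

  elt-suc : ∀ i k → elt i k + p ≡ elt i (suc k)
  elt-suc i k = trans (ℕₚ.+-assoc i (k * p) p) (cong (λ w → i + w) (ℕₚ.+-comm (k * p) p))

  elt-zero : ∀ i → elt i 0 ≡ i
  elt-zero = ℕₚ.+-identityʳ

  Increasing Decreasing Empty : ℕ → Set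
  Increasing i = ∀ k l → k < l → elt i k ≺ elt i l
  Decreasing i = ∀ k l → k < l → elt i l ≺ elt i k
  Empty i      = ∀ k → ¬ Image (elt i k)

  class-image : ∀ {i} → N ≤ i → ∀ k → Image i ⇔ Image (elt i k)
  class-image {i} le zero = subst (λ x → Image i ⇔ Image x) (sym (elt-zero i)) (⇔-id _)
  class-image {i} le (suc k) = subst (λ x → Image (elt i k) ⇔ Image x) (elt-suc i k)
    (image-periodic (elt i k) (ℕₚ.≤-trans le (ℕₚ.m≤m+n i (k * p)))) ⇔-∘ class-image le k

  class-step : ∀ {i} → N ≤ i → ∀ k → i ≺ i + p ⇔ elt i k ≺ elt i (suc k)
  class-step {i} le zero =
    subst₂ (λ x y → i ≺ i + p ⇔ x ≺ y) (sym (elt-zero i)) (cong (λ w → i + w) (sym (ℕₚ.+-identityʳ p))) (⇔-id _)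
  class-step {i} le (suc k) = subst₂ (λ x y → elt i k ≺ x ⇔ x ≺ y) (elt-suc i k)
    (trans (cong (_+ p) (elt-suc i k)) (elt-suc i (suc k)))
    (≺-periodic (elt i k) (ℕₚ.≤-trans le (ℕₚ.m≤m+n i (k * p)))) ⇔-∘ class-step le k

  elt-injective : ∀ i k → ¬ elt i k ≡ elt i (suc k)
  elt-injective i k eq = ℕₚ.<⇒≢ (ℕₚ.m<m+n (elt i k) (ℕ.>-nonZero⁻¹ p)) (trans eq (sym (elt-suc i k)))

  class-trichotomy : ∀ {i} → N ≤ i → Empty i ⊎ Increasing i ⊎ Decreasing i
  class-trichotomy {i} le with image? i
  ... | no ¬im = inj₁ λ k im → ¬im (from (class-image le k) im)
  ... | yes im with decide ≺-definable (env2 i (i + p))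
  ... | yes up = inj₂ (inj₁ (chain _≺_ ≺-trans (elt i) λ k → to (class-step le k) up))
  ... | no ¬up = inj₂ (inj₂ (chain (λ x y → y ≺ x) (λ f g → ≺-trans g f) (elt i) down))
    where
    down : ∀ k → elt i (suc k) ≺ elt i k
    -- The failure to ascend is the same at every step, and consecutive terms are distinct codes, so
    -- totality leaves only descent.
    down k with ≺-total (to (class-image le k) im) (to (class-image le (suc k)) im) (elt-injective i k)
    ... | inj₁ up = ⊥-elim (¬up (from (class-step le k) up))
    ... | inj₂ dn = dn

  ∈-class : ∀ x → N ≤ x → ∃ λ (i : Fin p) → ∃ λ k → x ≡ elt (N + toℕ i) k
  ∈-class x le = fromℕ< (m%n<n y p) , y / p ,
    (begin
      x                                             ≡⟨ ℕₚ.m+[n∸m]≡n le ⟨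
      N + y                                         ≡⟨ cong (λ w → N + w) (m≡m%n+[m/n]*n y p) ⟩
      N + (y % p + y / p * p)                       ≡⟨ ℕₚ.+-assoc N (y % p) _ ⟨
      N + y % p + y / p * p                         ≡⟨ cong (λ r → elt (N + r) (y / p)) (Finₚ.toℕ-fromℕ< (m%n<n y p)) ⟨
      elt (N + toℕ (fromℕ< (m%n<n y p))) (y / p)    ∎)
    where
    open ≡-Reasoning
    y = x ∸ N

  -- The codes of the elements of [ j b , (j + 1) b ).
  Interval : C → ℕ → ℕ → Set
  Interval b j y = ∃ λ a → a <ᴬ b × code (j ×ᴬ b +ᴬ a) ≡ y

  opaque
    -- The endpoints enter as the numbers `code b` and `code (j ×ᴬ b)`, themselves definable as
    -- numerals, so no parameters remain.
    interval-definable : ∀ b j → Definable {1} (λ ρ → Interval b j (ρ zero))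
    interval-definable b j = respᵈ (λ ρ → mk⇔ (fwd (ρ zero)) (bwd (ρ zero)))
      (∃ᵈ {P = λ ρ x → ∃ λ v → ∃ λ w → x ≺ v × v ≡ code b × w ≡ code (j ×ᴬ b) × Sum (ρ zero) w x}
        (∃ᵈ {P = λ ρ v → ∃ λ w → ρ zero ≺ v × v ≡ code b × w ≡ code (j ×ᴬ b) × Sum (ρ (suc zero)) w (ρ zero)}
          (∃ᵈ {P = λ ρ w → ρ (suc zero) ≺ ρ zero × ρ zero ≡ code b × w ≡ code (j ×ᴬ b) × Sum (ρ (suc (suc zero))) w (ρ (suc zero))}
            (at₂ (suc (suc zero)) (suc zero) ≺-definable ×ᵈ numeral (code b) (suc zero) ×ᵈ
             numeral (code (j ×ᴬ b)) zero ×ᵈ at₃ (suc (suc (suc zero))) zero (suc (suc zero)) sum-definable))))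
      where
      Witness : ℕ → Set
      Witness y = ∃ λ x → ∃ λ v → ∃ λ w → x ≺ v × v ≡ code b × w ≡ code (j ×ᴬ b) × Sum y w x
      fwd : ∀ y → Witness y → Interval b j y
      fwd y (x , v , w , (a , _ , refl , refl , lt) , ev , refl , (c , d , refl , ec , ed))
        with code-injective ev | code-injective ec | code-injective ed
      ... | refl | refl | refl = a , lt , refl
      bwd : ∀ y → Interval b j y → Witness y
      bwd y (a , lt , refl) = code a , code b , code (j ×ᴬ b) , (a , b , refl , refl , lt) , refl , refl ,
        (j ×ᴬ b , a , refl , refl , refl)

  interval-ordered : ∀ {b i j x y} → i < j → Interval b i x → Interval b j y → x ≺ y
  interval-ordered lt (a , a<b , refl) (c , _ , refl) = _ , _ , refl , refl , multiples-apart lt a<b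

  MeetsBeyond : C → ℕ → ℕ → ℕ → Set
  MeetsBeyond b j i B = ∃ λ k → ∃ λ y → B ≤ k × y ≡ elt i k × Interval b j y

  opaque
    meetsBeyond-definable : ∀ b j i → Definable {1} (λ ρ → MeetsBeyond b j i (ρ zero))
    meetsBeyond-definable b j i =
      ∃ᵈ {P = λ ρ k → ∃ λ y → ρ zero ≤ k × y ≡ elt i k × Interval b j y}
        (∃ᵈ {P = λ ρ y → ρ (suc zero) ≤ ρ zero × y ≡ elt i (ρ zero) × Interval b j y}
          (leq (suc (suc zero)) (suc zero) ×ᵈ progression i p zero (suc zero) ×ᵈ at₁ zero (interval-definable b j)))

  Cofinal : C → ℕ → ℕ → Set
  Cofinal b j i = ∀ B → MeetsBeyond b j i B

  -- The existence of a bound is a sentence over ℕ and can be decided. If it fails, deciding each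
  -- `MeetsBeyond` removes the double negation.
  bounded-or-cofinal : ∀ b j i → (∃ λ B → ¬ MeetsBeyond b j i B) ⊎ Cofinal b j i
  bounded-or-cofinal b j i
    with decide (∃ᵈ {n = 0} {P = λ _ B → ¬ MeetsBeyond b j i B} (¬ᵈ meetsBeyond-definable b j i)) empty
  ... | yes bounded = inj₁ bounded
  ... | no unbounded = inj₂ λ B → meets B (decide (meetsBeyond-definable b j i) (env1 B))
    where
    meets : ∀ B → Dec (MeetsBeyond b j i B) → MeetsBeyond b j i B
    meets B (yes m) = m
    meets B (no ¬m) = ⊥-elim (unbounded (B , ¬m))

  -- A monotone sequence is cofinal in at most one of several consecutive intervals.
  cofinal-unique : ∀ {b i j r} → N ≤ r → i < j → Cofinal b i r → ¬ Cofinal b j r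
  cofinal-unique {b} {i} {j} {r} le i<j ci cj with class-trichotomy le
  ... | inj₁ none with ci 0
  ...   | k , _ , _ , refl , a , _ , eq = none k (_ , eq)
  -- Having reached the later interval at `k`, an increasing class would have to return to the
  -- earlier one at some `l > k`. For a decreasing class the two intervals exchange roles.
  cofinal-unique {b} {i} {j} {r} le i<j ci cj | inj₂ (inj₁ up) with cj 0
  ...   | k , _ , _ , refl , yk with ci (suc k)
  ...     | l , _ , k<l , refl , yl = ≺-asym (up k l k<l) (interval-ordered {b} i<j yl yk)
  cofinal-unique {b} {i} {j} {r} le i<j ci cj | inj₂ (inj₂ down) with ci 0
  ...   | k , _ , _ , refl , yk with cj (suc k)
  ...     | l , _ , k<l , refl , yl = ≺-asym (down k l k<l) (interval-ordered {b} i<j yk yl)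

  IntervalBound : C → ℕ → ℕ → Set
  IntervalBound b j B = ∀ y → Interval b j y → y < B

  interval-bounded : ∀ b j → (∀ (i : Fin p) → ∃ λ B → ¬ MeetsBeyond b j (N + toℕ i) B) →
    ∃ (IntervalBound b j)
  -- A member is below `N`, or is `N + i + k * p` with `i < p` and `k < B`.
  interval-bounded b j bounds = N + p + B * p , bounded
    where
    common = uniform-bound {P = λ i B → ¬ MeetsBeyond b j (N + toℕ i) B}
      (λ i B≤C ¬m (k , y , C≤k , rest) → ¬m (k , y , ℕₚ.≤-trans B≤C C≤k , rest)) bounds
    B = proj₁ common
    bounded : ∀ y → Interval b j y → y < N + p + B * p
    bounded y iy with y ℕ.<? N
    ... | yes y<N = ℕₚ.<-≤-trans y<N (ℕₚ.≤-trans (ℕₚ.m≤m+n N p) (ℕₚ.m≤m+n (N + p) (B * p)))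
    ... | no y≮N with ∈-class y (ℕₚ.≮⇒≥ y≮N)
    ... | i , k , eq with k ℕ.<? B
    ... | no k≮B = ⊥-elim (proj₂ common i (k , y , ℕₚ.≮⇒≥ k≮B , eq , iy))
    ... | yes k<B = subst (_< N + p + B * p) (sym eq) (ℕₚ.+-mono-<-≤
      (ℕₚ.+-monoʳ-< N (Finₚ.toℕ<n i)) (ℕₚ.*-monoˡ-≤ p (ℕₚ.<⇒≤ k<B)))

  -- Codes do not respect translation, so the bound on a translate of `[ 0 , b )` is transferred by
  -- finiteness: each of the finitely many codes below `B` has at most one preimage, found or
  -- excluded by `dec`.
  preimage-bounded : ∀ (t : C → C) → (∀ {a b} → t a ≡ t b → a ≡ b) → (∀ c → Dec (∃ λ a → t a ≡ c)) →
    ∀ B → ∃ λ B′ → ∀ a → code (t a) < B → code a < B′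
  preimage-bounded t inj dec zero = 0 , λ _ ()
  preimage-bounded t inj dec (suc B) with preimage-bounded t inj dec B | hit
    where
    hit : Dec (∃ λ a → code (t a) ≡ B)
    hit with image? B
    ... | no ¬im = no λ { (a , eq) → ¬im (t a , eq) }
    ... | yes (c , eq) with dec c
    ... | yes (a , refl) = yes (a , eq)
    ... | no ¬pre = no λ { (a , eq′) → ¬pre (a , code-injective (trans eq′ (sym eq))) }
  ... | B′ , h | no ¬hit = B′ , λ a lt → h a (ℕₚ.≤∧≢⇒< (ℕₚ.≤-pred lt) λ eq → ¬hit (a , eq))
  ... | B′ , h | yes (a₀ , eq₀) = suc (code a₀) ⊔ B′ , bound
    where
    bound : ∀ a → code (t a) < suc B → code a < suc (code a₀) ⊔ B′
    bound a lt with code (t a) ℕ.≟ B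
    ... | yes eq = subst (λ c → code c < suc (code a₀) ⊔ B′) (inj (code-injective (trans eq₀ (sym eq))))
      (ℕₚ.m≤m⊔n (suc (code a₀)) B′)
    ... | no ne = ℕₚ.<-≤-trans (h a (ℕₚ.≤∧≢⇒< (ℕₚ.≤-pred lt) ne)) (ℕₚ.m≤n⊔m (suc (code a₀)) B′)

  translate? : ∀ c d → Dec (∃ λ a → c +ᴬ a ≡ d)
  translate? c d with compare c d
  ... | inj₁ (_ , le) = yes le
  ... | inj₂ (inj₁ refl) = yes ≤-refl
  ... | inj₂ (inj₂ lt) = no λ le → <-irrefl (<-≤-trans lt le)

  -- There are p residue classes, so one of p + 1 consecutive translates of [ 0 , b ) has bounded codes.
  predecessors-bounded : ∀ b → ∃ λ B → ∀ a → a <ᴬ b → code a < B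
  predecessors-bounded b with search {suc p} {λ j → ∃ (IntervalBound b (toℕ j))}
      {λ j → ∃ λ i → Cofinal b (toℕ j) (N + toℕ i)} alternatives
    where
    alternatives : ∀ (j : Fin (suc p)) → ∃ (IntervalBound b (toℕ j)) ⊎ ∃ (λ i → Cofinal b (toℕ j) (N + toℕ i))
    alternatives j with search {p} {λ i → Cofinal b (toℕ j) (N + toℕ i)} (λ i → swap (bounded-or-cofinal b (toℕ j) (N + toℕ i)))
      where
      swap : ∀ {P Q : Set} → P ⊎ Q → Q ⊎ P
      swap (inj₁ x) = inj₂ x
      swap (inj₂ y) = inj₁ y
    ... | inj₁ cofinal = inj₂ cofinal
    ... | inj₂ bounded = inj₁ (interval-bounded b (toℕ j) bounded)
  ... | inj₂ cofinal with Finₚ.pigeonhole (ℕₚ.n<1+n p) (proj₁ ∘ cofinal)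
  ...   | i , j , i<j , eq = ⊥-elim (cofinal-unique (ℕₚ.m≤m+n N _) i<j (proj₂ (cofinal i))
            (subst (λ r → Cofinal b (toℕ j) (N + toℕ r)) (sym eq) (proj₂ (cofinal j))))
  predecessors-bounded b | inj₁ (j , B , bounded)
    with preimage-bounded (toℕ j ×ᴬ b +ᴬ_) (+-cancelˡ (toℕ j ×ᴬ b) _ _) (translate? (toℕ j ×ᴬ b)) B
  ... | B′ , h = B′ , λ a a<b → h a (bounded _ (a , a<b , refl))

  -- Subtracting 1 from `a` up to `B + 1` times either reaches 0 or leaves some `c` for which
  -- `c , c + 1 , … , c + B` are `B + 1` distinct predecessors of `a` with codes below `B`.
  standard : ∀ a → ∃ λ n → a ≡ numeralᴬ n
  standard a with predecessors-bounded a
  ... | B , bounded with peel (suc B)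
    where
    peel : ∀ n → (∃ λ m → a ≡ numeralᴬ m) ⊎ (∃ λ c → a ≡ c +ᴬ numeralᴬ n)
    peel zero = inj₂ (a , sym (+-identityʳ a))
    peel (suc n) with peel n
    ... | inj₁ done = inj₁ done
    ... | inj₂ (c , eq) with zero-or-suc c
    ... | inj₁ refl = inj₁ (n , trans eq (+-identityˡ _))
    ... | inj₂ (d , refl) = inj₂ (d , trans eq (trans (+-assoc d 1ᴬ _) (cong (d +ᴬ_) (+-comm 1ᴬ _))))
  ... | inj₁ done = done
  ... | inj₂ (c , eq) = ⊥-elim (collide (Finₚ.pigeonhole (ℕₚ.n<1+n B) code′))
    where
    below : ∀ (i : Fin (suc B)) → c +ᴬ numeralᴬ (toℕ i) <ᴬ a
    below i = subst (c +ᴬ numeralᴬ (toℕ i) <ᴬ_) (sym eq) (+-monoʳ-< c (numeral-mono-< (Finₚ.toℕ<n i)))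
    code′ : Fin (suc B) → Fin B
    code′ i = fromℕ< (bounded _ (below i))
    collide : ¬ ∃ λ i → ∃ λ j → i Fin.< j × code′ i ≡ code′ j
    collide (i , j , i<j , e) = ℕₚ.<⇒≢ i<j (numeral-injective (+-cancelˡ c _ _ (code-injective
      (trans (sym (Finₚ.toℕ-fromℕ< (bounded _ (below i)))) (trans (cong toℕ e) (Finₚ.toℕ-fromℕ< (bounded _ (below j))))))))

  -- The isomorphism with ℕ

  value : C → ℕ
  value a = proj₁ (standard a)

  numeral-value : ∀ a → numeralᴬ (value a) ≡ a
  numeral-value a = sym (proj₂ (standard a))

  value-numeral : ∀ n → value (numeralᴬ n) ≡ n
  value-numeral n = numeral-injective (numeral-value (numeralᴬ n))

  isomorphism : Isomorphic A ℕStr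
  isomorphism = value ,
    ((λ {a} {b} eq → trans (sym (numeral-value a)) (trans (cong numeralᴬ eq) (numeral-value b))) ,
     (λ n → numeralᴬ n , λ { refl → value-numeral n })) ,
    λ a b → numeral-injective (trans (numeral-value (a +ᴬ b))
      (trans (cong₂ _+ᴬ_ (sym (numeral-value a)) (sym (numeral-value b))) (sym (×-homo-+ (value a) (value b) 1ᴬ))))

  -- Counting predecessors class by class

  decreasing-impossible : ∀ {i} → Image i → ¬ Decreasing i
  decreasing-impossible {i} (b , refl) down with predecessors-bounded b
  -- Term `suc B` is a predecessor of `b`, yet its code `i + suc B * p` is at least `B`. The
  -- successor also makes the index positive, as `down` requires.
  ... | B , bounded with down 0 (suc B) (s≤s z≤n)
  ... | a , _ , ea , eb , lt = ℕₚ.<⇒≱ (bounded a (subst (a <ᴬ_) (code-injective (trans eb (elt-zero i))) lt))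
    (subst (B ≤_) (sym ea) (ℕₚ.≤-trans (ℕₚ.n≤1+n B) (ℕₚ.≤-trans (ℕₚ.m≤m*n (suc B) p) (ℕₚ.m≤n+m (suc B * p) i))))

  -- Every number is elt i k for exactly one pair with i < N + p and Slot i k.
  Slot : ℕ → ℕ → Set
  Slot i k = N ≤ i ⊎ k ≡ 0

  slot : ∀ x → ∃ λ i → ∃ λ k → i < N + p × Slot i k × x ≡ elt i k
  slot x with x ℕ.<? N
  ... | yes x<N = x , 0 , ℕₚ.<-≤-trans x<N (ℕₚ.m≤m+n N p) , inj₂ refl , sym (elt-zero x)
  ... | no x≮N with ∈-class x (ℕₚ.≮⇒≥ x≮N)
  ... | i , k , eq = N + toℕ i , k , ℕₚ.+-monoʳ-< N (Finₚ.toℕ<n i) , inj₁ (ℕₚ.m≤m+n N (toℕ i)) , eq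

  -- If `l > k`, then `l` is nonzero, the slot forces `N ≤ j`, and `j + l * p` is at least a full
  -- period above `N + k * p`, beyond `i + k * p`.
  slot-≤ : ∀ {i j k l} → i < N + p → Slot j l → elt i k ≡ elt j l → l ≤ k
  slot-≤ {i} {j} {k} {l} i< sl eq with l ℕ.≤? k
  ... | yes le = le
  ... | no l≰k = ⊥-elim (ℕₚ.<⇒≢ (begin-strict
      i + k * p         <⟨ ℕₚ.+-monoˡ-< (k * p) i< ⟩
      N + p + k * p     ≡⟨ ℕₚ.+-assoc N p (k * p) ⟩
      N + suc k * p     ≤⟨ ℕₚ.+-mono-≤ N≤j (ℕₚ.*-monoˡ-≤ p (ℕₚ.≰⇒> l≰k)) ⟩
      j + l * p         ∎) eq)
    where
    open ℕₚ.≤-Reasoning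
    N≤j : N ≤ j
    N≤j = [ (λ le → le) , (λ { refl → ⊥-elim (l≰k z≤n) }) ] sl

  slot-unique : ∀ {i j k l} → i < N + p → j < N + p → Slot i k → Slot j l → elt i k ≡ elt j l → i ≡ j × k ≡ l
  slot-unique {i} {j} {k} {l} i< j< si sj eq with ℕₚ.≤-antisym (slot-≤ {l = k} j< si (sym eq)) (slot-≤ {l = l} i< sj eq)
  ... | refl = ℕₚ.+-cancelʳ-≡ (k * p) i j eq , refl

  Below : ℕ → ℕ → ℕ → Set
  Below i k x = Slot i k × elt i k ≺ x

  -- A class below `N` has a single slot, with nothing under it. Any other class that contains a
  -- code is increasing, because descent is excluded by the finiteness of predecessors.
  below-downward : ∀ {i k l x} → l < k → Below i k x → Below i l x
  below-downward {i} {k} {l} lt (inj₂ refl , _) = ⊥-elim (ℕₚ.n≮0 lt)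
  below-downward {i} {k} {l} lt (inj₁ N≤i , le@(a , _ , ea , _)) with class-trichotomy N≤i
  ... | inj₁ none = ⊥-elim (none k (a , ea))
  ... | inj₂ (inj₁ up) = inj₁ N≤i , ≺-trans (up l k lt) le
  ... | inj₂ (inj₂ down) = ⊥-elim (decreasing-impossible (from (class-image N≤i k) (a , ea)) down)

  total-below : ℕ → (ℕ → ℕ) → ℕ
  total-below zero    κ = 0
  total-below (suc j) κ = total-below j κ + κ j

  total-cong : ∀ j {κ κ′} → (∀ i → i < j → κ i ≡ κ′ i) → total-below j κ ≡ total-below j κ′
  total-cong zero    h = refl
  total-cong (suc j) h = cong₂ _+_ (total-cong j λ i lt → h i (ℕₚ.m<n⇒m<1+n lt)) (h j ℕₚ.≤-refl)

  total-zero : ∀ j → total-below j (λ _ → 0) ≡ 0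
  total-zero zero    = refl
  total-zero (suc j) = trans (ℕₚ.+-identityʳ _) (total-zero j)

  bump : ℕ → (ℕ → ℕ) → ℕ → ℕ
  bump i₀ κ i with i ℕ.≟ i₀
  ... | yes _ = suc (κ i)
  ... | no  _ = κ i

  bump-hit : ∀ i κ → bump i κ i ≡ suc (κ i)
  bump-hit i κ with i ℕ.≟ i
  ... | yes _ = refl
  ... | no ne = ⊥-elim (ne refl)

  bump-miss : ∀ {i i₀} κ → ¬ i ≡ i₀ → bump i₀ κ i ≡ κ i
  bump-miss {i} {i₀} κ ne with i ℕ.≟ i₀
  ... | yes eq = ⊥-elim (ne eq)
  ... | no _   = refl

  total-bump : ∀ {i₀ j} κ → i₀ < j → total-below j (bump i₀ κ) ≡ suc (total-below j κ)
  total-bump {i₀} {suc j} κ (s≤s le) with ℕₚ.m≤n⇒m<n∨m≡n le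
  ... | inj₁ lt = cong₂ _+_ (total-bump κ lt) (bump-miss κ (ℕₚ.<⇒≢ lt ∘ sym))
  ... | inj₂ refl = trans (cong₂ _+_ (total-cong j λ i lt → bump-miss κ (ℕₚ.<⇒≢ lt)) (bump-hit j κ))
    (ℕₚ.+-suc (total-below j κ) (κ j))

  Counts : (ℕ → ℕ) → ℕ → Set
  Counts κ x = ∀ i → i < N + p → ∀ k → Below i k x ⇔ k < κ i

  ≺-suc : ∀ {y} n → y ≺ code (numeralᴬ (suc n)) → ¬ y ≡ code (numeralᴬ n) → y ≺ code (numeralᴬ n)
  ≺-suc n (a , b , refl , eb , lt) ne = a , numeralᴬ n , refl , refl , ne ∘ cong code ,
    <-suc⇒≤ (subst (a <ᴬ_) (code-injective eb) lt)

  suc-≺ : ∀ n → code (numeralᴬ n) ≺ code (numeralᴬ (suc n))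
  suc-≺ n = _ , _ , refl , refl , x<x+1 (numeralᴬ n)

  -- Passing from n to n + 1 adds the single predecessor code n, which is the next element of its class.
  counts : ∀ n → ∃ λ κ → Counts κ (code (numeralᴬ n)) × total-below (N + p) κ ≡ n
  counts zero = (λ _ → 0) , (λ i _ k → mk⇔ (λ { (_ , a , b , _ , eb , lt) →
    ⊥-elim (≮0 (subst (a <ᴬ_) (code-injective eb) lt)) }) λ ()) , total-zero (N + p)
  counts (suc n) with counts n | slot (code (numeralᴬ n))
  ... | κ , h , sum | i₀ , k₀ , i₀< , s₀ , eq₀ =
    bump i₀ κ , count , trans (total-bump κ i₀<) (cong suc sum)
    where
    x x′ : ℕ
    x  = code (numeralᴬ n)
    x′ = code (numeralᴬ (suc n))

    grow : ∀ {i k} → Below i k x → Below i k x′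
    grow (s , lt) = s , ≺-trans lt (suc-≺ n)

    shrink : ∀ {i k} → Below i k x′ → ¬ elt i k ≡ x → Below i k x
    shrink (s , lt) ne = s , ≺-suc n lt ne

    new : Below i₀ k₀ x′
    new = s₀ , subst (_≺ x′) eq₀ (suc-≺ n)

    -- A larger count would put `x` below itself. With a smaller one, downward closure puts term
    -- `κ i₀` of the class below `x′`; being different from `x` it is below `x`, although the count
    -- omits it.
    next : κ i₀ ≡ k₀
    next with ℕₚ.<-cmp (κ i₀) k₀
    ... | tri≈ _ eq _ = eq
    ... | tri> _ _ gt = ⊥-elim (≺-asym x≺x x≺x)
      where
      x≺x : x ≺ x
      x≺x = subst (_≺ x) (sym eq₀) (proj₂ (from (h i₀ i₀< k₀) gt))
    ... | tri< lt _ _ = ⊥-elim (ℕₚ.<-irrefl refl (to (h i₀ i₀< (κ i₀)) (shrink (below-downward lt new)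
      λ e → ℕₚ.<⇒≢ lt (proj₂ (slot-unique i₀< i₀< (proj₁ (below-downward lt new)) s₀ (trans e eq₀))))))

    count : Counts (bump i₀ κ) x′
    count i i< k with i ℕ.≟ i₀
    ... | no ne = mk⇔
      (λ b → to (h i i< k) (shrink b λ e → ne (proj₁ (slot-unique i< i₀< (proj₁ b) s₀ (trans e eq₀)))))
      (grow ∘ from (h i i< k))
    ... | yes refl = mk⇔ fwd bwd
      where
      fwd : Below i k x′ → k < suc (κ i)
      fwd b with k ℕ.≟ k₀
      ... | yes eq = s≤s (ℕₚ.≤-reflexive (trans eq (sym next)))
      ... | no ne = ℕₚ.m<n⇒m<1+n (to (h i i< k)
        (shrink b λ e → ne (proj₂ (slot-unique i< i₀< (proj₁ b) s₀ (trans e eq₀)))))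
      bwd : k < suc (κ i) → Below i k x′
      bwd lt with ℕₚ.m≤n⇒m<n∨m≡n (ℕₚ.≤-pred lt)
      ... | inj₁ k<κ = grow (from (h i i< k) k<κ)
      ... | inj₂ eq  = subst (λ l → Below i l x′) (sym (trans eq next)) new

  -- The function `κ` of `Counts` cannot occur in a formula; its value at `i` is replaced by a
  -- number `v` that this condition determines.
  Initial : ℕ → ℕ → ℕ → Set
  Initial i x v = ∀ k → (Below i k x → k < v) × (k < v → Below i k x)

  initial-unique : ∀ {i x v w} → Initial i x v → Initial i x w → v ≡ w
  initial-unique {v = v} {w} hv hw with ℕₚ.<-cmp v w
  ... | tri≈ _ eq _ = eq
  ... | tri< lt _ _ = ⊥-elim (ℕₚ.<-irrefl refl (proj₁ (hv v) (proj₂ (hw v) lt)))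
  ... | tri> _ _ gt = ⊥-elim (ℕₚ.<-irrefl refl (proj₁ (hw w) (proj₂ (hv w) gt)))

  -- Count j x z: the first j classes together contain z predecessors of x.
  Count : ℕ → ℕ → ℕ → Set
  Count zero    x z = z ≡ 0
  Count (suc j) x z = ∃ λ u → ∃ λ v → Count j x u × Initial j x v × z ≡ u + v

  count-total : ∀ {κ x} → Counts κ x → ∀ j → j ≤ N + p → Count j x (total-below j κ)
  count-total h zero    le = refl
  count-total h (suc j) le = _ , _ , count-total h j (ℕₚ.<⇒≤ le) , (λ k → to (h j le k) , from (h j le k)) , refl

  count-unique : ∀ {x z w} j → Count j x z → Count j x w → z ≡ w
  count-unique zero    refl refl = refl
  count-unique (suc j) (u , v , c , i , refl) (u′ , v′ , c′ , i′ , refl) =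
    cong₂ _+_ (count-unique j c c′) (initial-unique i i′)

  opaque
    below-definable : ∀ i → Definable {2} (λ ρ → Below i (ρ zero) (ρ (suc zero)))
    below-definable i = slot-definable ×ᵈ respᵈ
      (λ ρ → mk⇔ (λ { (y , refl , lt) → lt }) (λ lt → _ , refl , lt))
      (∃ᵈ {P = λ ρ y → y ≡ elt i (ρ zero) × y ≺ ρ (suc zero)}
        (progression i p zero (suc zero) ×ᵈ at₂ zero (suc (suc zero)) ≺-definable))
      where
      slot-definable : Definable {2} (λ ρ → Slot i (ρ zero))
      slot-definable with N ℕ.≤? i
      -- Both `N` and `i` are fixed, so `N ≤ i` is settled outside the formula; `equal zero zero`
      -- serves as truth.
      ... | yes le = respᵈ (λ ρ → mk⇔ (λ _ → inj₁ le) (λ _ → refl)) (equal zero zero)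
      ... | no N≰i = respᵈ (λ ρ → mk⇔ inj₂ λ { (inj₁ le) → ⊥-elim (N≰i le) ; (inj₂ eq) → eq }) (isZero zero)

    initial-definable : ∀ i → Definable {2} (λ ρ → Initial i (ρ zero) (ρ (suc zero)))
    initial-definable i = ∀ᵈ {P = λ ρ k → (Below i k (ρ zero) → k < ρ (suc zero)) × (k < ρ (suc zero) → Below i k (ρ zero))}
      ((below →ᵈ below-v) ×ᵈ (below-v →ᵈ below))
      where
      below : Definable {3} (λ ρ → Below i (ρ zero) (ρ (suc zero)))
      below = at₂ zero (suc zero) (below-definable i)
      below-v : Definable {3} (λ ρ → ρ zero < ρ (suc (suc zero)))
      below-v = less zero (suc (suc zero))

    count-definable : ∀ j → Definable {2} (λ ρ → Count j (ρ zero) (ρ (suc zero)))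
    count-definable zero    = isZero (suc zero)
    count-definable (suc j) =
      ∃ᵈ {P = λ ρ u → ∃ λ v → Count j (ρ zero) u × Initial j (ρ zero) v × ρ (suc zero) ≡ u + v}
        (∃ᵈ {P = λ ρ v → Count j (ρ (suc zero)) (ρ zero) × Initial j (ρ (suc zero)) v × ρ (suc (suc zero)) ≡ ρ zero + v}
          (at₂ (suc (suc zero)) (suc zero) (count-definable j) ×ᵈ
           at₂ (suc (suc zero)) zero (initial-definable j) ×ᵈ
           plus (suc (suc (suc zero))) (suc zero) zero))

  -- The conjunct `Image x` excludes numbers that are not codes: they have no predecessors and would
  -- be paired with 0. For a code, `counts` provides the count and `count-unique` fixes it.
  numeral-code-definable : Definable {2} (λ ρ → code (numeralᴬ (ρ (suc zero))) ≡ ρ zero)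
  numeral-code-definable = respᵈ (λ ρ → mk⇔ (fwd (ρ zero) (ρ (suc zero))) (bwd (ρ zero) (ρ (suc zero))))
    (at₁ zero image-definable ×ᵈ count-definable (N + p))
    where
    bwd : ∀ x z → code (numeralᴬ z) ≡ x → Image x × Count (N + p) x z
    bwd x z refl with counts z
    ... | κ , h , eq = (_ , refl) , subst (Count (N + p) x) eq (count-total h (N + p) ℕₚ.≤-refl)
    fwd : ∀ x z → Image x × Count (N + p) x z → code (numeralᴬ z) ≡ x
    fwd x z ((a , refl) , c) = cong code (trans (cong numeralᴬ z≡value) (numeral-value a))
      where
      z≡value : z ≡ value a
      z≡value = count-unique (N + p) c (subst (λ b → Count (N + p) (code b) (value a)) (numeral-value a)
        (proj₂ (bwd _ (value a) refl)))

-- Codes from an interpretation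

least : ∀ {P : ℕ → Set} → (∀ n → Dec (P n)) → ∀ n → P n → ∃ λ m → P m × (∀ k → k < m → ¬ P k)
least {P} P? = <-rec _ step
  where
  step : ∀ n → (∀ {m} → m < n → P m → ∃ λ l → P l × (∀ k → k < l → ¬ P k)) →
    P n → ∃ λ m → P m × (∀ k → k < m → ¬ P k)
  step n rec pn with ℕₚ.anyUpTo? P? n
  ... | yes (m , m<n , pm) = rec m<n pm
  ... | no ¬any = n , pn , λ k k<n pk → ¬any (k , k<n , pk)

module Interpreted (A : Structure) (model : ModelOfPrA A) (ι : Translation1)
  (h : D ι → Carrier A) (int : IsInterpretation ι A h) where

  open Model A model
  open IsInterpretation int using (surj; kernel; ~-refl) renaming (plus to plus-correct)

  Represents : ℕ → C → Set
  Represents x a = Σ (InD ι x) λ x∈D → h (x , x∈D) ≡ a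

  -- A number may satisfy the domain formula by different proofs, and `h` takes the proof as input;
  -- reflexivity of `~` makes the results agree.
  h-irrelevant : ∀ {x} (q q′ : InD ι x) → h (x , q) ≡ h (x , q′)
  h-irrelevant {x} q q′ = from (kernel (x , q) (x , q′)) (~-refl (x , q))

  represents-functional : ∀ {x a b} → Represents x a → Represents x b → a ≡ b
  represents-functional (q , refl) (q′ , refl) = h-irrelevant q q′

  represents? : ∀ a x → Dec (Represents x a)
  represents? a x with surj a | sat? (Dom ι) (env1 x)
  ... | _ | no ¬q = no (¬q ∘ proj₁)
  ... | d , refl | yes q = map′ (λ e → q , from (kernel (x , q) d) e)
    (λ { (q′ , eq) → to (kernel (x , q) d) (trans (h-irrelevant q q′) eq) })
    (sat? (Eq ι) (env2 x (proj₁ d)))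

  representative : ∀ a → ∃ λ x → Represents x a × (∀ y → y < x → ¬ Represents y a)
  representative a = least (represents? a) (proj₁ (proj₁ (surj a))) (proj₂ (proj₁ (surj a)) , proj₂ (surj a))

  leastCode : C → ℕ
  leastCode a = proj₁ (representative a)

  represents-leastCode : ∀ a → Represents (leastCode a) a
  represents-leastCode a = proj₁ (proj₂ (representative a))

  leastCode-minimal : ∀ a y → y < leastCode a → ¬ Represents y a
  leastCode-minimal a = proj₂ (proj₂ (representative a))

  leastCode-injective : ∀ {a b} → leastCode a ≡ leastCode b → a ≡ b
  leastCode-injective {a} {b} eq = represents-functional (represents-leastCode a)
    (subst (λ x → Represents x b) (sym eq) (represents-leastCode b))

  -- Renaming is applied to the formula directly, because `env1 (ρ i)` and `ρ ∘ extend i empty`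
  -- agree only pointwise.
  dom-definable : ∀ {n} (i : Fin n) → Definable (λ ρ → InD ι (ρ i))
  dom-definable i = rename (extend i empty) (Dom ι) by λ ρ → sat-rename _ (λ { zero → refl }) (Dom ι)

  eq-definable : ∀ {n} (i j : Fin n) → Definable (λ ρ → ρ i ~[ ι ] ρ j)
  eq-definable i j = rename (extend i (extend j empty)) (Eq ι) by λ ρ →
    sat-rename _ (λ { zero → refl ; (suc zero) → refl }) (Eq ι)

  plus-definable : ∀ {n} (i j k : Fin n) → Definable (λ ρ → ℕ⊨ (Plus ι) (env3 (ρ i) (ρ j) (ρ k)))
  plus-definable i j k = rename (extend i (extend j (extend k empty))) (Plus ι) by λ ρ →
    sat-rename _ (λ { zero → refl ; (suc zero) → refl ; (suc (suc zero)) → refl }) (Plus ι)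

  Code : ℕ → Set
  Code x = ∃ λ a → leastCode a ≡ x

  code-definable : Definable {1} (λ ρ → Code (ρ zero))
  code-definable = respᵈ (λ ρ → mk⇔ (fwd (ρ zero)) (bwd (ρ zero)))
    (dom-definable zero ×ᵈ ∀ᵈ {P = λ ρ y → y < ρ zero → InD ι y → ¬ (y ~[ ι ] ρ zero)}
      (less zero (suc zero) →ᵈ dom-definable zero →ᵈ ¬ᵈ eq-definable zero (suc zero)))
    where
    fwd : ∀ x → InD ι x × (∀ y → y < x → InD ι y → ¬ (y ~[ ι ] x)) → Code x
    fwd x (q , min) with ℕₚ.<-cmp (leastCode (h (x , q))) x | represents-leastCode (h (x , q))
    ... | tri≈ _ eq _ | _ = _ , eq
    ... | tri< lt _ _ | q′ , eq = ⊥-elim (min _ lt q′ (to (kernel (_ , q′) (x , q)) eq))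
    ... | tri> _ _ gt | _ = ⊥-elim (leastCode-minimal (h (x , q)) x gt (q , refl))
    bwd : ∀ x → Code x → InD ι x × (∀ y → y < x → InD ι y → ¬ (y ~[ ι ] x))
    bwd x (a , refl) = proj₁ (represents-leastCode a) , λ y y<x q y~x →
      leastCode-minimal a y y<x (q , trans (from (kernel (y , q) (x , proj₁ (represents-leastCode a))) y~x)
        (proj₂ (represents-leastCode a)))

  coding : Coding
  coding = record
    { code            = leastCode
    ; code-injective  = leastCode-injective
    ; image-definable = code-definable
    ; sum-definable   = respᵈ (λ ρ → mk⇔ (fwd (ρ zero) (ρ (suc zero)) (ρ (suc (suc zero))))
                                         (bwd (ρ zero) (ρ (suc zero)) (ρ (suc (suc zero)))))
        (at₁ zero code-definable ×ᵈ at₁ (suc zero) code-definable ×ᵈ at₁ (suc (suc zero)) code-definable ×ᵈ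
         plus-definable zero (suc zero) (suc (suc zero)))
    }
    where
    SumCodes : ℕ → ℕ → ℕ → Set
    SumCodes x y z = ∃ λ a → ∃ λ b → leastCode (a +ᴬ b) ≡ x × leastCode a ≡ y × leastCode b ≡ z
    point : C → D ι
    point a = leastCode a , proj₁ (represents-leastCode a)
    h-point : ∀ a → h (point a) ≡ a
    h-point a = proj₂ (represents-leastCode a)
    fwd : ∀ x y z → Code x × Code y × Code z × ℕ⊨ (Plus ι) (env3 x y z) → SumCodes x y z
    fwd x y z ((c , refl) , (a , refl) , (b , refl) , s) = a , b , cong leastCode
      (trans (cong₂ _+ᴬ_ (sym (h-point a)) (sym (h-point b)))
        (trans (sym (from (plus-correct (point c) (point a) (point b)) s)) (h-point c))) , refl , refl
    bwd : ∀ x y z → SumCodes x y z → Code x × Code y × Code z × ℕ⊨ (Plus ι) (env3 x y z)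
    bwd x y z (a , b , refl , refl , refl) = (_ , refl) , (_ , refl) , (_ , refl) ,
      to (plus-correct (point (a +ᴬ b)) (point a) (point b))
        (trans (h-point (a +ᴬ b)) (cong₂ _+ᴬ_ (sym (h-point a)) (sym (h-point b))))

  open Coded A model coding using (standard; isomorphism; numeral-code-definable) public

  -- Counting treats only least representatives; `~` carries the relation to the whole equivalence
  -- class. The resulting formula defines the isomorphism.
  represents-numeral-definable : Definable {2} (λ ρ → Represents (ρ zero) (numeralᴬ (ρ (suc zero))))
  represents-numeral-definable = respᵈ (λ ρ → mk⇔ (fwd (ρ zero) (ρ (suc zero))) (bwd (ρ zero) (ρ (suc zero))))
    (dom-definable zero ×ᵈ ∃ᵈ {P = λ ρ y → leastCode (numeralᴬ (ρ (suc zero))) ≡ y × y ~[ ι ] ρ zero}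
      (at₂ zero (suc (suc zero)) numeral-code-definable ×ᵈ eq-definable zero (suc zero)))
    where
    fwd : ∀ x n → InD ι x × (∃ λ y → leastCode (numeralᴬ n) ≡ y × y ~[ ι ] x) → Represents x (numeralᴬ n)
    fwd x n (q , y , refl , y~x) with represents-leastCode (numeralᴬ n)
    ... | q′ , eq = q , trans (sym (from (kernel (y , q′) (x , q)) y~x)) eq
    bwd : ∀ x n → Represents x (numeralᴬ n) → InD ι x × (∃ λ y → leastCode (numeralᴬ n) ≡ y × y ~[ ι ] x)
    bwd x n (q , eq) with represents-leastCode (numeralᴬ n)
    ... | q′ , eq′ = q , _ , refl , to (kernel (_ , q′) (x , q)) (trans eq′ (sym eq))

  trivial-interpretation : IsInterpretation trivial A (λ d → numeralᴬ (proj₁ d))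
  trivial-interpretation = record
    { nonempty = 0 , tt
    ; ~-refl   = λ _ → refl
    ; ~-sym    = λ _ _ → sym
    ; ~-trans  = λ _ _ _ → trans
    ; surj     = λ a → (proj₁ (standard a) , tt) , sym (proj₂ (standard a))
    ; kernel   = λ _ _ → mk⇔ numeral-injective (cong numeralᴬ)
    ; plus     = λ { (l , _) (m , _) (n , _) → mk⇔
        (λ eq → numeral-injective (trans eq (sym (×-homo-+ m n 1ᴬ))))
        (λ eq → trans (cong numeralᴬ eq) (×-homo-+ m n 1ᴬ)) }
    }

  definably-isomorphic : DefinablyIsomorphic ι trivial A
  definably-isomorphic = formula represents-numeral-definable , h , int , _ , trivial-interpretation ,
    λ { (x , q) (n , _) → ⇔-sym (correct represents-numeral-definable (env2 x n)) ⇔-∘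
      mk⇔ (λ eq → q , eq) (λ { (q′ , eq) → trans (h-irrelevant q q′) eq }) }

theorem1 : (A : Structure) → ModelOfPrA A →
    (ι : Translation1) → Interprets ι A →
    Isomorphic A ℕStr × DefinablyIsomorphic ι trivial A
theorem1 A model ι (h , int) = isomorphism , definably-isomorphic
  where
  open Interpreted A model ι h int
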